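{- Let $n\ge 2$. The $n\times n$ matrix $$G_{n} = \begin{pmatrix} 2 & 4 & 8 & 16 & 32 & \cdots & 2^{n} \\ 2 & 2 & 4 & 8 & 16 & \cdots & 2^{n-1} \\ 0 & 2 & 2 & 4 & 8 & \cdots & 2^{n-2} \\ 0 & 0 & 2 & 2 & 4 & \cdots & 2^{n-3} \\ 0 & 0 & 0 & 2 & 2 & \cdots & 2^{n-4} \\ \vdots & \vdots & \vdots & \vdots & \vdots & \ddots & \vdots \\ 0 & 0 & 0 & 0 & 0 & \cdots & 2 \end{pmatrix}$$ (whose $(p,q)$ entry is $2^{q-p+1}$ if $q\ge p$, $2$ if $q=p-1$, and $0$ if $q<p-1$) is a production matrix for plane geometric graphs of point sets in convex position; that is, $v^{i+1}=G_n v^i$ for all $i$ with $2\le i\le n$.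
   Context: A geometric graph on a finite point set $\mathcal S\subseteq\mathbb R^2$ has vertex set $\mathcal S$ and edges that are straight-line segments with endpoints in $\mathcal S$; it is plane if no two edges intersect except at common endpoints. Graphs with $i$ vertices are considered on points $p_1,\dots,p_i$ in convex position labelled in counter-clockwise order. Two vertices are visible (from each other) if the line segment connecting them does not intersect the interior of any edge of the graph. The visibility degree of the root vertex $p_i$ of a graph on $\{p_1,\dots,p_i\}$ is the number of vertices visible from an additional vertex $p_{i+1}$ inserted between $p_i$ and $p_1$ in convex position, minus $2$. For $2\le i\le n+1$, $v^i$ is the $n$-dimensional column vector whose $j$-th entry is the number of plane geometric graphs on $i$ points in convex position whose root vertex has visibility degree $j-1$ (so $v^2=(2,0,\dots,0)^\top$). A production matrix is a matrix satisfying $v^{i+1}=G_nv^i$. -}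

module Defs where

open import Algebra.Core using (Op₁; Op₂)
import Algebra.Properties.Monoid.Sum as Sum
open import Algebra.Structures using (IsCommutativeRing)
open import Data.Bool using (Bool; true; false; if_then_else_)
open import Data.Fin as Fin using (Fin; toℕ; fromℕ; inject₁)
open import Data.List using (List; length)
open import Data.List.Membership.Propositional using (_∈_)
open import Data.List.Relation.Unary.Unique.Propositional using (Unique)
open import Data.Nat as ℕ using (ℕ; suc; _∸_; _^_; _≤_; _≤ᵇ_; _≡ᵇ_)
import Data.Nat.Properties as ℕ
open import Data.Product using (_×_; _,_; ∃-syntax; Σ-syntax)
open import Data.Sum using (_⊎_)
open import Data.Vec using (Vec; lookup)
open import Data.Vec.Functional using (Vector)
open import Function.Bundles using (_⇔_)
open import Level as Level using (_⊔_)
open import Relation.Binary using (Rel; IsStrictTotalOrder)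
import Relation.Binary.Construct.StrictToNonStrict as StrictToNonStrict
open import Relation.Binary.PropositionalEquality using (_≡_; _≗_)
open import Relation.Nullary using (¬_)
open import Relation.Unary using (Pred)

-- Stands in for ℝ, which is (classically) an instance: everything below
-- makes sense over an arbitrary ordered field.
record OrderedField c ℓ₁ ℓ₂ : Set (Level.suc (c ⊔ ℓ₁ ⊔ ℓ₂)) where
  infixl 7 _*_
  infixl 6 _+_ _-_
  infix  8 -_
  infix  4 _≈_ _<_
  field
    Carrier            : Set c
    _≈_                : Rel Carrier ℓ₁
    _<_                : Rel Carrier ℓ₂
    _+_ _*_            : Op₂ Carrier
    -_                 : Op₁ Carrier
    0# 1#              : Carrier
    isCommutativeRing  : IsCommutativeRing _≈_ _+_ _*_ -_ 0# 1#
    isStrictTotalOrder : IsStrictTotalOrder _≈_ _<_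
    0≉1                : ¬ (0# ≈ 1#)
    inverse            : ∀ x → ¬ (x ≈ 0#) → ∃[ y ] (x * y ≈ 1#)
    +-monoˡ-<          : ∀ x {y z} → y < z → y + x < z + x
    *-pos              : ∀ {x y} → 0# < x → 0# < y → 0# < x * y

  open StrictToNonStrict _≈_ _<_ public using () renaming (_≤_ to _≤ᶠ_)

  _-_ : Op₂ Carrier
  x - y = x + (- y)

record HasCardinality {a ℓ} {A : Set a} (P : Pred A ℓ) (k : ℕ) : Set (a ⊔ ℓ) where
  field
    elements : List A
    unique   : Unique elements
    ∈⇔P      : ∀ x → x ∈ elements ⇔ P x
    size     : length elements ≡ k

-- The laws are irrelevant so that graphs with the same adjacency matrix are
-- propositionally equal, hence counted once.
record Graph (i : ℕ) : Set where
  field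
    adjacency : Vec (Vec Bool i) i

  adjacent : Fin i → Fin i → Bool
  adjacent a b = lookup (lookup adjacency a) b

  field
    .symmetric   : ∀ a b → adjacent a b ≡ adjacent b a
    .irreflexive : ∀ a → adjacent a a ≡ false

  Edge : Fin i → Fin i → Set
  Edge a b = adjacent a b ≡ true

open Graph public using (Edge)

module Geometry {c ℓ₁ ℓ₂} (F : OrderedField c ℓ₁ ℓ₂) where
  open OrderedField F

  Point : Set c
  Point = Carrier × Carrier

  infix 4 _≈ₚ_
  _≈ₚ_ : Rel Point ℓ₁
  (x , y) ≈ₚ (x′ , y′) = x ≈ x′ × y ≈ y′

  along : Point → Point → Carrier → Point
  along (x , y) (x′ , y′) t = x + t * (x′ - x) , y + t * (y′ - y)

  OnSegment : Point → Point → Point → Set (c ⊔ ℓ₁ ⊔ ℓ₂)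
  OnSegment p q x = ∃[ t ] (0# ≤ᶠ t × t ≤ᶠ 1# × x ≈ₚ along p q t)

  -- The interior of a segment is relative to its line.
  InInterior : Point → Point → Point → Set (c ⊔ ℓ₁ ⊔ ℓ₂)
  InInterior p q x = ∃[ t ] (0# < t × t < 1# × x ≈ₚ along p q t)

  orientation : Point → Point → Point → Carrier
  orientation (x₁ , y₁) (x₂ , y₂) (x₃ , y₃) =
    (x₂ - x₁) * (y₃ - y₁) - (y₂ - y₁) * (x₃ - x₁)

  -- Convex position (no three points collinear), labelled counter-clockwise:
  -- every triple taken in the order of its labels makes a left turn.
  ConvexCCW : ∀ {m} → (Fin m → Point) → Set ℓ₂
  ConvexCCW p = ∀ {a b c} → a Fin.< b → b Fin.< c →
                0# < orientation (p a) (p b) (p c)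

  Plane : ∀ {i} → (Fin i → Point) → Graph i → Set (c ⊔ ℓ₁ ⊔ ℓ₂)
  Plane p G = ∀ {a b c d} → Edge G a b → Edge G c d →
    ¬ ((a ≡ c × b ≡ d) ⊎ (a ≡ d × b ≡ c)) →
    ∀ x → OnSegment (p a) (p b) x → OnSegment (p c) (p d) x →
    ∃[ m ] ((m ≡ a ⊎ m ≡ b) × (m ≡ c ⊎ m ≡ d) × x ≈ₚ p m)

  Visible : ∀ {i} → (Fin i → Point) → Graph i → Point → Point → Set (c ⊔ ℓ₁ ⊔ ℓ₂)
  Visible p G u w = ∀ {a b} → Edge G a b →
    ∀ x → OnSegment u w x → ¬ InInterior (p a) (p b) x

  -- In a configuration of i + 1 points, the first i carry the graph (the root
  -- being the last of these), and the final one is the additional point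
  -- inserted between the root and the first point.
  vertices : ∀ {i} → (Fin (suc i) → Point) → Fin i → Point
  vertices p k = p (inject₁ k)

  extra : ∀ {i} → (Fin (suc i) → Point) → Point
  extra {i} p = p (fromℕ i)

  HasVisibilityDegree : ∀ {i} → (Fin (suc i) → Point) → Graph i → ℕ →
                        Set (c ⊔ ℓ₁ ⊔ ℓ₂)
  HasVisibilityDegree p G d =
    HasCardinality (λ k → Visible (vertices p) G (extra p) (vertices p k)) (d ℕ.+ 2)

  -- Vector entries are indexed from 0, so entry j is for visibility degree j.
  IsVisibilityVector : ∀ {i n} → (Fin (suc i) → Point) → Vector ℕ n →
                       Set (c ⊔ ℓ₁ ⊔ ℓ₂)
  IsVisibilityVector p v = ∀ j →
    HasCardinality (λ G → Plane (vertices p) G × HasVisibilityDegree p G (toℕ j)) (v j)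

Matrix : ℕ → Set
Matrix n = Fin n → Fin n → ℕ

infixr 7 _·_
_·_ : ∀ {n} → Matrix n → Vector ℕ n → Vector ℕ n
_·_ {n} M v r = ∑[ s < n ] (M r s ℕ.* v s)
  where open Sum ℕ.+-0-monoid using (sum-syntax)

G : ∀ n → Matrix n
G n r s =
  if toℕ r ≤ᵇ toℕ s then 2 ^ (toℕ s ∸ toℕ r ℕ.+ 1)
  else if toℕ r ≡ᵇ toℕ s ℕ.+ 1 then 2
  else 0

-- The vectors vⁱ (2 ≤ i ≤ n + 1) exist, do not depend on the chosen points, and
-- satisfy the recurrence; cardinalities being unique, they are determined by
-- the first component.
IsProductionMatrix : ∀ {c ℓ₁ ℓ₂} → OrderedField c ℓ₁ ℓ₂ → ∀ n → Matrix n →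
                     Set (c ⊔ ℓ₁ ⊔ ℓ₂)
IsProductionMatrix F n M = Σ[ v ∈ (ℕ → Vector ℕ n) ]
    (∀ i → 2 ≤ i → i ≤ suc n → (p : Fin (suc i) → Point) → ConvexCCW p →
       IsVisibilityVector p (v i))
  × (∀ i → 2 ≤ i → i ≤ n → v (suc i) ≗ M · v i)
  where open Geometry F

{-# OPTIONS --safe #-}
-- Seen from the root, a plane graph on i + 1 points is a plane graph on i points
-- together with a set N of neighbours of the new root within the set S of visible
-- vertices, since an edge to a covered vertex would cross the edge covering it.
-- Afterwards the visible vertices are the new root and the members of S with label
-- at most that of the first member of N (all of S if N is empty), so a graph with
-- ∣ S ∣ = d + 2 has 2 ^ (d - j + 1) extensions of degree j ≤ d and 2 of
-- degree d + 1.  Crossing and covering depend only on the cyclic order of the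
-- labels because an orientation is an affine function of its last point, so that
-- its signs at the endpoints of a segment decide whether the segment meets a line.
-- Both notions are invariant under reversing the labels, which allows new
-- vertices to be added in front, as index zero.
module Submission where

open import Defs
open import Data.Nat using (ℕ; _≤_)

open import Algebra.Bundles using (CommutativeRing; RawRing)
import Algebra.Properties.AbelianGroup as AbelianGroupProperties
import Algebra.Properties.CommutativeMonoid.Sum as Sum
import Algebra.Properties.CommutativeSemigroup as CommutativeSemigroupProperties
import Algebra.Properties.Ring as RingProperties
import Algebra.Properties.Semiring.Mult as Mult
import Algebra.Solver.Ring as RingSolver
open import Algebra.Solver.Ring.AlmostCommutativeRing using (fromCommutativeRing; _-Raw-AlmostCommutative⟶_)
open import Data.Bool as Bool using (Bool; true; false; not; _∧_; _∨_; if_then_else_; T)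
import Data.Bool.Properties as Bool
open import Data.Empty using (⊥; ⊥-elim)
open import Data.Fin as Fin using (Fin; zero; suc; toℕ; fromℕ; inject₁)
import Data.Fin.Properties as Fin
open import Data.Fin.Subset using (∣_∣)
open import Data.Fin.Subset.Properties using (∣p∣≤n)
open import Data.List as List using (List; []; _∷_; length; map; _++_; cartesianProductWith; filterᵇ; allFin)
open import Data.List.Membership.Propositional using (_∈_)
open import Data.List.Membership.Propositional.Properties
  using (∈-map⁺; ∈-map⁻; ∈-cartesianProductWith⁺; ∈-allFin; ∈-filter⁺; ∈-filter⁻)
open import Data.List.Membership.Propositional.Properties.WithK using (unique∧set⇒bag)
import Data.List.Properties as List
open import Data.List.Relation.Binary.BagAndSetEquality using (∼bag⇒↭)
open import Data.List.Relation.Binary.Permutation.Propositional.Properties using (↭-length)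
open import Data.List.Relation.Unary.All using ([]; _∷_)
open import Data.List.Relation.Unary.AllPairs using ([]; _∷_)
open import Data.List.Relation.Unary.Any using (here; there)
open import Data.List.Relation.Unary.Unique.Propositional using (Unique)
import Data.List.Relation.Unary.Unique.Propositional.Properties as Unique
open import Data.Maybe using (Maybe; just; nothing)
open import Data.Nat as ℕ using (zero; suc; z≤n; s≤s; _∸_)
import Data.Nat.Properties as ℕ
open import Data.Product using (_×_; _,_; ∃-syntax; proj₁; proj₂)
open import Data.Sum as Sum⊎ using (_⊎_; inj₁; inj₂)
open import Data.Vec as Vec using (Vec; []; _∷_; lookup; tabulate)
import Data.Vec.Properties as Vec
open import Function using (_∘_; id; _⇔_; mk⇔; Equivalence)
open import Function.Properties.Equivalence using () renaming (sym to ⇔-sym; trans to ⇔-trans)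
open import Relation.Binary using (IsStrictTotalOrder; tri<; tri≈; tri>)
open import Relation.Binary.PropositionalEquality as ≡ using (_≡_; _≢_; _≗_)
import Relation.Binary.Reasoning.Setoid as SetoidReasoning
open import Relation.Nullary using (¬_; yes; no; recompute)

-- Ring identities with integer coefficients

-- Ring identities are normalised with integer coefficients, an integer being a
-- pair (m , n) standing for m - n.  Normal forms are compared syntactically, so
-- the pairs are kept reduced.
module IntegerSolver {c ℓ} (R : CommutativeRing c ℓ) where
  open CommutativeRing R
  open RingProperties ring using (-‿distribˡ-*; -‿distribʳ-*)
  open AbelianGroupProperties +-abelianGroup using (⁻¹-∙-comm; ⁻¹-involutive; ε⁻¹≈ε)
  open Mult semiring using (×-homo-+; ×1-homo-*; ×-homo-1) renaming (_×_ to _×′_)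
  open CommutativeSemigroupProperties +-commutativeSemigroup using (interchange)
  open SetoidReasoning setoid

  reduce : ℕ × ℕ → ℕ × ℕ
  reduce (a , b) = a ∸ b , b ∸ a

  coefficients : RawRing _ _
  coefficients = record
    { Carrier = ℕ × ℕ
    ; _≈_     = _≡_
    ; _+_     = λ (a , b) (c , d) → reduce (a ℕ.+ c , b ℕ.+ d)
    ; _*_     = λ (a , b) (c , d) → reduce (a ℕ.* c ℕ.+ b ℕ.* d , a ℕ.* d ℕ.+ b ℕ.* c)
    ; -_      = λ (a , b) → b , a
    ; 0#      = 0 , 0
    ; 1#      = 1 , 0
    }

  ⟦_⟧ : ℕ × ℕ → Carrier
  ⟦ a , b ⟧ = a ×′ 1# - b ×′ 1#

  -‿interchange : ∀ w x y z → (w + x) - (y + z) ≈ (w - y) + (x - z)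
  -‿interchange w x y z = begin
    (w + x) - (y + z)       ≈⟨ +-congˡ (⁻¹-∙-comm y z) ⟨
    (w + x) + (- y + - z)   ≈⟨ interchange w x (- y) (- z) ⟩
    (w - y) + (x - z)       ∎

  -- Multiplicativity of `⟦_⟧`, with the images of the four natural numbers replaced by arbitrary
  -- ring elements.
  -‿*-expand : ∀ w x y z → (w * y + x * z) - (w * z + x * y) ≈ (w - x) * (y - z)
  -‿*-expand w x y z = begin
    (w * y + x * z) - (w * z + x * y)      ≈⟨ -‿interchange _ _ _ _ ⟩
    (w * y - w * z) + (x * z - x * y)      ≈⟨ +-cong (+-congˡ (-‿distribʳ-* w z))
                                                   (trans (+-comm _ _) (+-cong (-‿distribˡ-* x y) (sym -x*-z))) ⟩
    (w * y + w * - z) + (- x * y + - x * - z) ≈⟨ +-cong (distribˡ w y (- z)) (distribˡ (- x) y (- z)) ⟨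
    w * (y - z) + - x * (y - z)            ≈⟨ distribʳ (y - z) w (- x) ⟨
    (w - x) * (y - z)                      ∎
    where
    -x*-z : - x * - z ≈ x * z
    -x*-z = begin
      - x * - z     ≈⟨ -‿distribˡ-* x (- z) ⟨
      - (x * - z)   ≈⟨ -‿cong (-‿distribʳ-* x z) ⟨
      - - (x * z)   ≈⟨ ⁻¹-involutive (x * z) ⟩
      x * z         ∎

  +-homo : ∀ a b c d → ⟦ a ℕ.+ c , b ℕ.+ d ⟧ ≈ ⟦ a , b ⟧ + ⟦ c , d ⟧
  +-homo a b c d = trans (+-cong (×-homo-+ 1# a c) (-‿cong (×-homo-+ 1# b d))) (-‿interchange _ _ _ _)

  *+*-homo : ∀ a b c d → (a ℕ.* b ℕ.+ c ℕ.* d) ×′ 1# ≈ a ×′ 1# * b ×′ 1# + c ×′ 1# * d ×′ 1#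
  *+*-homo a b c d = trans (×-homo-+ 1# (a ℕ.* b) (c ℕ.* d)) (+-cong (×1-homo-* a b) (×1-homo-* c d))

  ⟦⟧-cong : ∀ a b c d → a ℕ.+ d ≡ c ℕ.+ b → ⟦ a , b ⟧ ≈ ⟦ c , d ⟧
  ⟦⟧-cong a b c d a+d≡c+b = begin
    ⟦ a , b ⟧                       ≈⟨ +-identityʳ _ ⟨
    ⟦ a , b ⟧ + 0#                  ≈⟨ +-congˡ (-‿inverseʳ _) ⟨
    ⟦ a , b ⟧ + ⟦ d , d ⟧           ≈⟨ +-homo a b d d ⟨
    ⟦ a ℕ.+ d , b ℕ.+ d ⟧           ≡⟨ ≡.cong₂ (λ m n → ⟦ m , n ⟧) a+d≡c+b (ℕ.+-comm b d) ⟩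
    ⟦ c ℕ.+ b , d ℕ.+ b ⟧           ≈⟨ +-homo c d b b ⟩
    ⟦ c , d ⟧ + ⟦ b , b ⟧           ≈⟨ +-congˡ (-‿inverseʳ _) ⟩
    ⟦ c , d ⟧ + 0#                  ≈⟨ +-identityʳ _ ⟩
    ⟦ c , d ⟧                       ∎

  ⟦reduce⟧ : ∀ x → ⟦ reduce x ⟧ ≈ ⟦ x ⟧
  ⟦reduce⟧ (a , b) = ⟦⟧-cong (a ∸ b) (b ∸ a) a b (exchange a b)
    where
    exchange : ∀ a b → (a ∸ b) ℕ.+ b ≡ a ℕ.+ (b ∸ a)
    exchange zero    zero    = ≡.refl
    exchange zero    (suc b) = ≡.refl
    exchange (suc a) zero    = ≡.refl
    exchange (suc a) (suc b) = ≡.trans (ℕ.+-suc (a ∸ b) b) (≡.cong suc (exchange a b))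

  -- Agrees with ⟦_⟧, but sends the constants 0 and 1 to 0# and 1# on the nose.
  value : ℕ × ℕ → Carrier
  value (0 , 0) = 0#
  value (1 , 0) = 1#
  value x       = ⟦ x ⟧

  value≈⟦⟧ : ∀ x → value x ≈ ⟦ x ⟧
  value≈⟦⟧ (0 , 0)           = sym (-‿inverseʳ 0#)
  value≈⟦⟧ (1 , 0)           = sym (trans (+-cong (×-homo-1 1#) ε⁻¹≈ε) (+-identityʳ 1#))
  value≈⟦⟧ (suc (suc _) , 0) = refl
  value≈⟦⟧ (0 , suc _)       = refl
  value≈⟦⟧ (1 , suc _)       = refl
  value≈⟦⟧ (suc (suc _) , suc _) = refl

  value∘reduce : ∀ a b → value (reduce (a , b)) ≈ ⟦ a , b ⟧
  value∘reduce a b = trans (value≈⟦⟧ (reduce (a , b))) (⟦reduce⟧ (a , b))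

  morphism : coefficients -Raw-AlmostCommutative⟶ fromCommutativeRing R
  morphism = record
    { ⟦_⟧    = value
    ; +-homo = λ { x@(a , b) y@(c , d) → begin
        value (reduce (a ℕ.+ c , b ℕ.+ d))  ≈⟨ value∘reduce (a ℕ.+ c) (b ℕ.+ d) ⟩
        ⟦ a ℕ.+ c , b ℕ.+ d ⟧      ≈⟨ +-homo a b c d ⟩
        ⟦ x ⟧ + ⟦ y ⟧              ≈⟨ +-cong (value≈⟦⟧ x) (value≈⟦⟧ y) ⟨
        value x + value y          ∎ }
    ; *-homo = λ { x@(a , b) y@(c , d) → begin
        value (reduce (a ℕ.* c ℕ.+ b ℕ.* d , a ℕ.* d ℕ.+ b ℕ.* c))
          ≈⟨ value∘reduce (a ℕ.* c ℕ.+ b ℕ.* d) (a ℕ.* d ℕ.+ b ℕ.* c) ⟩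
        ⟦ a ℕ.* c ℕ.+ b ℕ.* d , a ℕ.* d ℕ.+ b ℕ.* c ⟧
          ≈⟨ +-cong (*+*-homo a c b d) (-‿cong (*+*-homo a d b c)) ⟩
        _                     ≈⟨ -‿*-expand (a ×′ 1#) (b ×′ 1#) (c ×′ 1#) (d ×′ 1#) ⟩
        ⟦ x ⟧ * ⟦ y ⟧         ≈⟨ *-cong (value≈⟦⟧ x) (value≈⟦⟧ y) ⟨
        value x * value y     ∎ }
    ; -‿homo = λ { x@(a , b) → begin
        value (b , a)             ≈⟨ value≈⟦⟧ (b , a) ⟩
        b ×′ 1# - a ×′ 1#         ≈⟨ +-comm _ _ ⟩
        - (a ×′ 1#) + b ×′ 1#     ≈⟨ +-congˡ (⁻¹-involutive _) ⟨
        - (a ×′ 1#) - - (b ×′ 1#) ≈⟨ ⁻¹-∙-comm _ _ ⟩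
        - ⟦ x ⟧                   ≈⟨ -‿cong (value≈⟦⟧ x) ⟨
        - value x                 ∎ }
    ; 0-homo = refl
    ; 1-homo = refl
    }

  -- A sufficient test is all that the solver asks for. In positive characteristic distinct integers
  -- may have equal images, and these are not detected.
  _coeff≟_ : ∀ x y → Maybe (value x ≈ value y)
  x@(a , b) coeff≟ y@(c , d) with a ℕ.+ d ℕ.≟ c ℕ.+ b
  ... | yes a+d≡c+b = just (trans (value≈⟦⟧ x) (trans (⟦⟧-cong a b c d a+d≡c+b) (sym (value≈⟦⟧ y))))
  ... | no  _       = nothing

  open RingSolver coefficients (fromCommutativeRing R) morphism _coeff≟_ public
    using (Polynomial; solve; con; _:=_; _:+_; _:*_; _:-_; :-_)


-- Arithmetic of ordered fields

module OrderedFieldProperties {c ℓ₁ ℓ₂} (F : OrderedField c ℓ₁ ℓ₂) where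
  open OrderedField F
  open IsStrictTotalOrder isStrictTotalOrder public
    using (compare; irrefl; asym; <-respʳ-≈; <-respˡ-≈) renaming (trans to <-trans)

  commutativeRing : CommutativeRing _ _
  commutativeRing = record { isCommutativeRing = isCommutativeRing }

  open CommutativeRing commutativeRing public
    using (refl; sym; trans; setoid; +-cong; +-congˡ; +-congʳ; +-identityˡ; +-identityʳ; -‿inverseʳ; -‿cong;
           *-congˡ; *-congʳ; *-identityʳ; zeroʳ)
  open IntegerSolver commutativeRing public
  open SetoidReasoning setoid

  :0 :1 : ∀ {m} → Polynomial m
  :0 = con (0 , 0)
  :1 = con (1 , 0)

  ≤-respʳ-≈ : ∀ {x y z} → y ≈ z → x ≤ᶠ y → x ≤ᶠ z
  ≤-respʳ-≈ y≈z (inj₁ x<y) = inj₁ (<-respʳ-≈ y≈z x<y)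
  ≤-respʳ-≈ y≈z (inj₂ x≈y) = inj₂ (trans x≈y y≈z)

  x<y⇒0<y-x : ∀ {x y} → x < y → 0# < y - x
  x<y⇒0<y-x {x} x<y = <-respˡ-≈ (-‿inverseʳ x) (+-monoˡ-< (- x) x<y)

  0<y-x⇒x<y : ∀ {x y} → 0# < y - x → x < y
  0<y-x⇒x<y {x} {y} 0<y-x = <-respˡ-≈ (+-identityˡ x)
    (<-respʳ-≈ (solve 2 (λ x y → (y :- x) :+ x := y) refl x y) (+-monoˡ-< x 0<y-x))

  x≤y⇒0≤y-x : ∀ {x y} → x ≤ᶠ y → 0# ≤ᶠ y - x
  x≤y⇒0≤y-x (inj₁ x<y) = inj₁ (x<y⇒0<y-x x<y)
  x≤y⇒0≤y-x {x} (inj₂ x≈y) = inj₂ (trans (sym (-‿inverseʳ x)) (+-congʳ x≈y))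

  0≤y-x⇒x≤y : ∀ {x y} → 0# ≤ᶠ y - x → x ≤ᶠ y
  0≤y-x⇒x≤y (inj₁ 0<y-x) = inj₁ (0<y-x⇒x<y 0<y-x)
  0≤y-x⇒x≤y {x} {y} (inj₂ 0≈y-x) = inj₂ (begin
    x            ≈⟨ +-identityˡ x ⟨
    0# + x       ≈⟨ +-congʳ 0≈y-x ⟩
    (y - x) + x  ≈⟨ solve 2 (λ x y → (y :- x) :+ x := y) refl x y ⟩
    y            ∎)

  +-pos : ∀ {x y} → 0# < x → 0# < y → 0# < x + y
  +-pos {x} {y} 0<x 0<y = <-trans 0<y (<-respˡ-≈ (+-identityˡ y) (+-monoˡ-< y 0<x))

  +-nonNeg-pos : ∀ {x y} → 0# ≤ᶠ x → 0# < y → 0# < x + y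
  +-nonNeg-pos (inj₁ 0<x) 0<y = +-pos 0<x 0<y
  +-nonNeg-pos {x} {y} (inj₂ 0≈x) 0<y = <-respʳ-≈ (trans (sym (+-identityˡ y)) (+-congʳ 0≈x)) 0<y

  *-nonNeg : ∀ {x y} → 0# ≤ᶠ x → 0# ≤ᶠ y → 0# ≤ᶠ x * y
  *-nonNeg (inj₁ 0<x) (inj₁ 0<y) = inj₁ (*-pos 0<x 0<y)
  *-nonNeg {x} {y} (inj₂ 0≈x) _ = inj₂ (trans (solve 1 (λ y → :0 := :0 :* y) refl y) (*-congʳ 0≈x))
  *-nonNeg {x} {y} _ (inj₂ 0≈y) = inj₂ (trans (sym (zeroʳ x)) (*-congˡ 0≈y))

  -- If 1 were negative, then -1 would be positive, and so would be its square, which is 1.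
  0<1 : 0# < 1#
  0<1 with compare 0# 1#
  ... | tri< 0<1 _ _ = 0<1
  ... | tri≈ _ 0≈1 _ = ⊥-elim (0≉1 0≈1)
  ... | tri> _ _ 1<0 = <-respʳ-≈ (solve 0 ((:0 :- :1) :* (:0 :- :1) := :1) refl) (*-pos 0<-1 0<-1)
    where
    0<-1 : 0# < 0# - 1#
    0<-1 = x<y⇒0<y-x 1<0

  inverse-pos : ∀ {x y} → 0# < x → x * y ≈ 1# → 0# < y
  inverse-pos {x} {y} 0<x x*y≈1 with compare 0# y
  ... | tri< 0<y _ _ = 0<y
  ... | tri≈ _ 0≈y _ = ⊥-elim (0≉1 (begin
    0#      ≈⟨ zeroʳ x ⟨
    x * 0#  ≈⟨ *-congˡ 0≈y ⟩
    x * y   ≈⟨ x*y≈1 ⟩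
    1#      ∎))
  -- A negative `y` would make `x * (0# - y)` positive, but this is -1.
  ... | tri> _ _ y<0 = ⊥-elim (asym 0<1 (0<y-x⇒x<y (<-respʳ-≈
    (trans (solve 2 (λ x y → x :* (:0 :- y) := :0 :- x :* y) refl x y) (+-congˡ (-‿cong x*y≈1)))
    (*-pos 0<x (x<y⇒0<y-x y<0)))))

  1-‿involutive : ∀ t → 1# - (1# - t) ≈ t
  1-‿involutive = solve 1 (λ t → :1 :- (:1 :- t) := t) refl

  -- Rewritten as `(1# - t) * x + t * y`, the value is positive as soon as `t` is.
  interpolation-zero : ∀ {x y t} → 0# ≤ᶠ x → 0# < y → 0# ≤ᶠ t → t ≤ᶠ 1# →
                       x + t * (y - x) ≈ 0# → t ≈ 0#
  interpolation-zero _ _ (inj₂ 0≈t) _ _ = sym 0≈t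
  interpolation-zero {x} {y} {t} 0≤x 0<y (inj₁ 0<t) t≤1 eq = ⊥-elim (irrefl (sym eq)
    (<-respʳ-≈ (solve 3 (λ x y t → (:1 :- t) :* x :+ t :* y := x :+ t :* (y :- x)) refl x y t)
      (+-nonNeg-pos (*-nonNeg (x≤y⇒0≤y-x t≤1) 0≤x) (*-pos 0<t 0<y))))

-- Orientations and the intersection of segments

module GeometryProperties {c ℓ₁ ℓ₂} (F : OrderedField c ℓ₁ ℓ₂) where
  open OrderedField F
  open OrderedFieldProperties F
  open Geometry F
  open SetoidReasoning setoid

  :orientation : ∀ {m} (x₁ y₁ x₂ y₂ x₃ y₃ : Polynomial m) → Polynomial m
  :orientation x₁ y₁ x₂ y₂ x₃ y₃ = (x₂ :- x₁) :* (y₃ :- y₁) :- (y₂ :- y₁) :* (x₃ :- x₁)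

  ≈ₚ-trans : ∀ {p q r} → p ≈ₚ q → q ≈ₚ r → p ≈ₚ r
  ≈ₚ-trans (x≈ , y≈) (x≈′ , y≈′) = trans x≈ x≈′ , trans y≈ y≈′

  orientation-cycle : ∀ a b c → orientation b c a ≈ orientation a b c
  orientation-cycle (x₁ , y₁) (x₂ , y₂) (x₃ , y₃) = solve 6
    (λ x₁ y₁ x₂ y₂ x₃ y₃ → :orientation x₂ y₂ x₃ y₃ x₁ y₁ := :orientation x₁ y₁ x₂ y₂ x₃ y₃)
    refl x₁ y₁ x₂ y₂ x₃ y₃

  orientation-start : ∀ a b → orientation a b a ≈ 0#
  orientation-start (x₁ , y₁) (x₂ , y₂) = solve 4
    (λ x₁ y₁ x₂ y₂ → :orientation x₁ y₁ x₂ y₂ x₁ y₁ := :0) refl x₁ y₁ x₂ y₂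

  orientation-end : ∀ a b → orientation a b b ≈ 0#
  orientation-end (x₁ , y₁) (x₂ , y₂) = solve 4
    (λ x₁ y₁ x₂ y₂ → :orientation x₁ y₁ x₂ y₂ x₂ y₂ := :0) refl x₁ y₁ x₂ y₂

  orientation-congʳ : ∀ a b {p q} → p ≈ₚ q → orientation a b p ≈ orientation a b q
  orientation-congʳ a b (x≈ , y≈) = +-cong (*-congˡ (+-congʳ y≈)) (-‿cong (*-congˡ (+-congʳ x≈)))

  orientation-along : ∀ a b p q t →
    orientation a b (along p q t) ≈ orientation a b p + t * (orientation a b q - orientation a b p)
  orientation-along (x₁ , y₁) (x₂ , y₂) (x₃ , y₃) (x₄ , y₄) t = solve 9
    (λ x₁ y₁ x₂ y₂ x₃ y₃ x₄ y₄ t →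
      :orientation x₁ y₁ x₂ y₂ (x₃ :+ t :* (x₄ :- x₃)) (y₃ :+ t :* (y₄ :- y₃)) :=
      :orientation x₁ y₁ x₂ y₂ x₃ y₃ :+
        t :* (:orientation x₁ y₁ x₂ y₂ x₄ y₄ :- :orientation x₁ y₁ x₂ y₂ x₃ y₃))
    refl x₁ y₁ x₂ y₂ x₃ y₃ x₄ y₄ t

  along-zero : ∀ p q {t} → t ≈ 0# → along p q t ≈ₚ p
  along-zero (x₁ , y₁) (x₂ , y₂) t≈0 = coordinate x₁ x₂ , coordinate y₁ y₂
    where
    coordinate : ∀ u v → _
    coordinate u v = trans (+-congˡ (*-congʳ t≈0)) (solve 2 (λ u v → u :+ :0 :* (v :- u) := u) refl u v)

  along-reverse : ∀ p q t → along p q t ≈ₚ along q p (1# - t)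
  along-reverse (x₁ , y₁) (x₂ , y₂) t = coordinate x₁ x₂ t , coordinate y₁ y₂ t
    where
    coordinate : ∀ u v t → u + t * (v - u) ≈ v + (1# - t) * (u - v)
    coordinate = solve 3 (λ u v t → u :+ t :* (v :- u) := v :+ (:1 :- t) :* (u :- v)) refl

  OnSegment-sym : ∀ {p q x} → OnSegment p q x → OnSegment q p x
  OnSegment-sym {p} {q} (t , 0≤t , t≤1 , x≈) =
    1# - t , x≤y⇒0≤y-x t≤1 , 0≤y-x⇒x≤y (≤-respʳ-≈ (sym (1-‿involutive t)) 0≤t) ,
    ≈ₚ-trans x≈ (along-reverse p q t)

  InInterior-sym : ∀ {p q x} → InInterior p q x → InInterior q p x
  InInterior-sym {p} {q} (t , 0<t , t<1 , x≈) =
    1# - t , x<y⇒0<y-x t<1 , 0<y-x⇒x<y (<-respʳ-≈ (sym (1-‿involutive t)) 0<t) ,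
    ≈ₚ-trans x≈ (along-reverse p q t)

  OnSegment⇒collinear : ∀ {a b x} → OnSegment a b x → orientation a b x ≈ 0#
  OnSegment⇒collinear {a} {b} {x} (t , _ , _ , x≈) = begin
    orientation a b x                 ≈⟨ orientation-congʳ a b x≈ ⟩
    orientation a b (along a b t)     ≈⟨ orientation-along a b a b t ⟩
    orientation a b a + t * (orientation a b b - orientation a b a)
      ≈⟨ +-cong (orientation-start a b)
           (*-congˡ (+-cong (orientation-end a b) (-‿cong (orientation-start a b)))) ⟩
    0# + t * (0# - 0#)                ≈⟨ solve 1 (λ t → :0 :+ t :* (:0 :- :0) := :0) refl t ⟩
    0#                                ∎

  -- A segment lying weakly on the left of a line, and ending strictly on the
  -- left of it, can meet this line only at its start.
  parameter-zero : ∀ {a b p q x} → 0# ≤ᶠ orientation a b p → 0# < orientation a b q →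
    OnSegment a b x → ((t , _) : OnSegment p q x) → t ≈ 0#
  parameter-zero {a} {b} {p} {q} 0≤p 0<q ab (t , 0≤t , t≤1 , x≈) =
    interpolation-zero 0≤p 0<q 0≤t t≤1 (begin
      _                              ≈⟨ orientation-along a b p q t ⟨
      orientation a b (along p q t)  ≈⟨ orientation-congʳ a b x≈ ⟨
      orientation a b _              ≈⟨ OnSegment⇒collinear ab ⟩
      0#                             ∎)

  meets-at-start : ∀ {a b p q x} → orientation a b p ≈ 0# → 0# < orientation a b q →
    OnSegment a b x → OnSegment p q x → x ≈ₚ p
  meets-at-start {p = p} {q} p≈0 0<q ab pq@(_ , _ , _ , x≈) =
    ≈ₚ-trans x≈ (along-zero p q (parameter-zero (inj₂ (sym p≈0)) 0<q ab pq))

  -- By `parameter-zero` a common point would be `p`, which is off the line.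
  separated : ∀ {a b p q x} → 0# < orientation a b p → 0# < orientation a b q →
    OnSegment a b x → ¬ OnSegment p q x
  separated {a} {b} {p} {q} 0<p 0<q ab pq@(_ , _ , _ , x≈) = irrefl
    (trans (sym (OnSegment⇒collinear ab))
      (orientation-congʳ a b (≈ₚ-trans x≈ (along-zero p q (parameter-zero (inj₁ 0<p) 0<q ab pq)))))
    0<p

  -- An interior point has a positive parameter, so the start `p` may even lie on the line.
  interior-separated : ∀ {a b p q x} → 0# ≤ᶠ orientation a b p → 0# < orientation a b q →
    OnSegment a b x → ¬ InInterior p q x
  interior-separated 0≤p 0<q ab (t , 0<t , t<1 , x≈) =
    irrefl (sym (parameter-zero 0≤p 0<q ab (t , inj₁ 0<t , inj₁ t<1 , x≈))) 0<t

  InInterior⇒OnSegment : ∀ {p q x} → InInterior p q x → OnSegment p q x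
  InInterior⇒OnSegment (t , 0<t , t<1 , x≈) = t , inj₁ 0<t , inj₁ t<1 , x≈

  -- By Cramer's rule the lines meet at parameters α / D and γ / D, where
  -- D = α + β = γ + δ.
  crossing : ∀ {a b c d} →
    0# < orientation c d a → 0# < orientation d c b →
    0# < orientation b a c → 0# < orientation a b d →
    ∃[ x ] (InInterior a b x × InInterior c d x)
  crossing {a@(x₁ , y₁)} {b@(x₂ , y₂)} {c@(x₃ , y₃)} {d@(x₄ , y₄)} 0<α 0<β 0<γ 0<δ =
    along a b (α * e) ,
    (α * e , *-pos 0<α 0<e , fraction<1 α+β≈D 0<β , refl , refl) ,
    (γ * e , *-pos 0<γ 0<e , fraction<1 γ+δ≈D 0<δ , meet x₁ x₂ x₃ x₄ x-meet , meet y₁ y₂ y₃ y₄ y-meet)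
    where
    α = orientation c d a
    β = orientation d c b
    γ = orientation b a c
    δ = orientation a b d
    D = α + β
    0<D : 0# < D
    0<D = +-pos 0<α 0<β
    D⁻¹ : ∃[ e ] (D * e ≈ 1#)
    D⁻¹ = inverse D (λ D≈0 → irrefl (sym D≈0) 0<D)
    e = proj₁ D⁻¹
    0<e : 0# < e
    0<e = inverse-pos 0<D (proj₂ D⁻¹)
    α+β≈D : α + β ≈ D
    α+β≈D = refl
    -- Both sums are twice the area of the quadrilateral `a`, `c`, `b`, `d`, cut along one diagonal
    -- or the other.
    γ+δ≈D : γ + δ ≈ D
    γ+δ≈D = solve 8 (λ x₁ y₁ x₂ y₂ x₃ y₃ x₄ y₄ →
        :orientation x₂ y₂ x₁ y₁ x₃ y₃ :+ :orientation x₁ y₁ x₂ y₂ x₄ y₄ :=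
        :orientation x₃ y₃ x₄ y₄ x₁ y₁ :+ :orientation x₄ y₄ x₃ y₃ x₂ y₂)
      refl x₁ y₁ x₂ y₂ x₃ y₃ x₄ y₄
    -- The complementary fraction `v * e` is `1# - u * e`, because `(u + v) * e` is 1.
    fraction<1 : ∀ {u v} → u + v ≈ D → 0# < v → u * e < 1#
    fraction<1 {u} {v} u+v≈D 0<v = 0<y-x⇒x<y (<-respʳ-≈ (begin
      v * e                 ≈⟨ solve 3 (λ u v e → v :* e := (u :+ v) :* e :- u :* e) refl u v e ⟩
      (u + v) * e - u * e   ≈⟨ +-congʳ (trans (*-congʳ u+v≈D) (proj₂ D⁻¹)) ⟩
      1# - u * e            ∎) (*-pos 0<v 0<e))
    scale : ∀ u → u ≈ u * D * e
    scale u = begin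
      u            ≈⟨ *-identityʳ u ⟨
      u * 1#       ≈⟨ *-congˡ (proj₂ D⁻¹) ⟨
      u * (D * e)  ≈⟨ solve 3 (λ u D e → u :* (D :* e) := u :* D :* e) refl u D e ⟩
      u * D * e    ∎
    -- Clearing the denominator turns the equality of a coordinate into a polynomial identity,
    -- namely `x-meet` or `y-meet`.
    meet : ∀ u₁ u₂ u₃ u₄ → u₁ * D + α * (u₂ - u₁) ≈ u₃ * D + γ * (u₄ - u₃) →
           u₁ + α * e * (u₂ - u₁) ≈ u₃ + γ * e * (u₄ - u₃)
    meet u₁ u₂ u₃ u₄ eq = begin
      u₁ + α * e * (u₂ - u₁)           ≈⟨ +-congʳ (scale u₁) ⟩
      u₁ * D * e + α * e * (u₂ - u₁)   ≈⟨ factor u₁ α (u₂ - u₁) ⟩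
      (u₁ * D + α * (u₂ - u₁)) * e     ≈⟨ *-congʳ eq ⟩
      (u₃ * D + γ * (u₄ - u₃)) * e     ≈⟨ factor u₃ γ (u₄ - u₃) ⟨
      u₃ * D * e + γ * e * (u₄ - u₃)   ≈⟨ +-congʳ (scale u₃) ⟨
      u₃ + γ * e * (u₄ - u₃)           ∎
      where
      factor : ∀ u κ v → u * D * e + κ * e * v ≈ (u * D + κ * v) * e
      factor u κ v = solve 5 (λ u D e κ v → u :* D :* e :+ κ :* e :* v := (u :* D :+ κ :* v) :* e) refl u D e κ v
    x-meet : x₁ * D + α * (x₂ - x₁) ≈ x₃ * D + γ * (x₄ - x₃)
    x-meet = solve 8 (λ x₁ y₁ x₂ y₂ x₃ y₃ x₄ y₄ →
        let α = :orientation x₃ y₃ x₄ y₄ x₁ y₁; D = α :+ :orientation x₄ y₄ x₃ y₃ x₂ y₂ in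
        x₁ :* D :+ α :* (x₂ :- x₁) := x₃ :* D :+ :orientation x₂ y₂ x₁ y₁ x₃ y₃ :* (x₄ :- x₃))
      refl x₁ y₁ x₂ y₂ x₃ y₃ x₄ y₄
    y-meet : y₁ * D + α * (y₂ - y₁) ≈ y₃ * D + γ * (y₄ - y₃)
    y-meet = solve 8 (λ x₁ y₁ x₂ y₂ x₃ y₃ x₄ y₄ →
        let α = :orientation x₃ y₃ x₄ y₄ x₁ y₁; D = α :+ :orientation x₄ y₄ x₃ y₃ x₂ y₂ in
        y₁ :* D :+ α :* (y₂ :- y₁) := y₃ :* D :+ :orientation x₂ y₂ x₁ y₁ x₃ y₃ :* (y₄ :- y₃))
      refl x₁ y₁ x₂ y₂ x₃ y₃ x₄ y₄

-- Convex position: crossing and covering in terms of labels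

-- For a symmetric relation one pattern of interleaving is enough: direct both edges upwards and
-- name the one with the smaller start first.
NonCrossing : ∀ {i} → (Fin i → Fin i → Set) → Set
NonCrossing E = ∀ {a b c d} → a Fin.< c → c Fin.< b → b Fin.< d → E a b → ¬ E c d

-- This is visibility from a point added before the first or after the last vertex: an edge blocks
-- the view of `k` when `k` lies strictly between its endpoints.
Uncovered : ∀ {i} → (Fin i → Fin i → Set) → Fin i → Set
Uncovered E k = ∀ {a b} → a Fin.< k → k Fin.< b → ¬ E a b

Edge-sym : ∀ {i} (G : Graph i) {a b} → Edge G a b → Edge G b a
Edge-sym record { symmetric = symmetric } {a} {b} ab = ≡.trans (recompute (_ Bool.≟ _) (symmetric b a)) ab

Edge-irrefl : ∀ {i} (G : Graph i) {a} → ¬ Edge G a a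
Edge-irrefl record { irreflexive = irreflexive } {a} aa =
  Bool.not-¬ aa (recompute (_ Bool.≟ _) (irreflexive a))

module ConvexPosition {c ℓ₁ ℓ₂} (F : OrderedField c ℓ₁ ℓ₂) where
  open OrderedField F
  open OrderedFieldProperties F
  open Geometry F
  open GeometryProperties F

  module _ {m} {p : Fin m → Point} (convex : ConvexCCW p) where

    left-bca : ∀ {a b c} → a Fin.< b → b Fin.< c → 0# < orientation (p b) (p c) (p a)
    left-bca a<b b<c = <-respʳ-≈ (sym (orientation-cycle _ _ _)) (convex a<b b<c)

    left-cab : ∀ {a b c} → a Fin.< b → b Fin.< c → 0# < orientation (p c) (p a) (p b)
    left-cab a<b b<c = <-respʳ-≈ (orientation-cycle _ _ _) (convex a<b b<c)

    -- The segments are the diagonals of the convex quadrilateral `a`, `c`, `b`, `d`, whose four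
    -- triples supply the orientations that `crossing` asks for.
    edges-cross : ∀ {a b c d} → a Fin.< c → c Fin.< b → b Fin.< d →
      ∃[ x ] (InInterior (p a) (p b) x × InInterior (p c) (p d) x)
    edges-cross a<c c<b b<d = crossing
      (left-bca a<c (Fin.<-trans c<b b<d)) (left-cab c<b b<d)
      (left-cab a<c c<b) (convex (Fin.<-trans a<c c<b) b<d)

    CommonEndpoint : Fin m → Fin m → Fin m → Fin m → Point → Set _
    CommonEndpoint a b c d x = ∃[ k ] ((k ≡ a ⊎ k ≡ b) × (k ≡ c ⊎ k ≡ d) × x ≈ₚ p k)

    swap-edges : ∀ {a b c d x} → CommonEndpoint a b c d x → CommonEndpoint c d a b x
    swap-edges (k , k∈ab , k∈cd , x≈k) = k , k∈cd , k∈ab , x≈k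

    reverseˡ : ∀ {a b c d x} → CommonEndpoint a b c d x → CommonEndpoint b a c d x
    reverseˡ (k , k∈ab , k∈cd , x≈k) = k , Sum⊎.swap k∈ab , k∈cd , x≈k

    reverseʳ : ∀ {a b c d x} → CommonEndpoint a b c d x → CommonEndpoint a b d c x
    reverseʳ (k , k∈ab , k∈cd , x≈k) = k , k∈ab , Sum⊎.swap k∈cd , x≈k

    -- Apart from interleaving, two distinct intervals of labels share an endpoint, are disjoint or
    -- are nested. A shared endpoint lies on the line of the other edge with the far end strictly on
    -- one side; in the other cases a whole edge is strictly on one side.
    meet-at-endpoint : ∀ {a b c d x} → a Fin.< b → c Fin.< d → a Fin.≤ c →
      ¬ (a ≡ c × b ≡ d) → ¬ (a Fin.< c × c Fin.< b × b Fin.< d) →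
      OnSegment (p a) (p b) x → OnSegment (p c) (p d) x → CommonEndpoint a b c d x
    meet-at-endpoint {a} {b} {c} {d} a<b c<d a≤c distinct uncrossed ab cd with Fin.<-cmp a c
    ... | tri> _ _ c<a = ⊥-elim (ℕ.<⇒≱ c<a a≤c)
    ... | tri≈ _ ≡.refl _ = a , inj₁ ≡.refl , inj₁ ≡.refl , x≈a
      where
      x≈a : _ ≈ₚ p a
      x≈a with Fin.<-cmp b d
      ... | tri< b<d _ _ = meets-at-start (orientation-start _ _) (convex a<b b<d) ab cd
      ... | tri≈ _ b≡d _ = ⊥-elim (distinct (≡.refl , b≡d))
      ... | tri> _ _ d<b = meets-at-start (orientation-end _ _) (left-cab c<d d<b) (OnSegment-sym ab) cd
    ... | tri< a<c _ _ with Fin.<-cmp b c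
    ...   | tri< b<c _ _ =
      ⊥-elim (separated (convex a<b b<c) (convex a<b (Fin.<-trans b<c c<d)) ab cd)
    ...   | tri≈ _ ≡.refl _ =
      b , inj₂ ≡.refl , inj₁ ≡.refl , meets-at-start (orientation-end _ _) (convex a<b c<d) ab cd
    ...   | tri> _ _ c<b with Fin.<-cmp b d
    ...     | tri< b<d _ _ = ⊥-elim (uncrossed (a<c , c<b , b<d))
    ...     | tri≈ _ ≡.refl _ = b , inj₂ ≡.refl , inj₂ ≡.refl ,
      meets-at-start (orientation-start _ _) (left-cab a<c c<b) (OnSegment-sym ab) (OnSegment-sym cd)
    -- A nested edge lies to the right of the line from `a` to `b`, hence to the left once this
    -- segment is reversed.
    ...     | tri> _ _ d<b = ⊥-elim
      (separated (left-cab a<c c<b) (left-cab (Fin.<-trans a<c c<d) d<b) (OnSegment-sym ab) cd)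

    -- The crossing point would have to be a vertex common to both edges, but the four labels are
    -- distinct.
    Plane⇒NonCrossing : ∀ (G : Graph m) → Plane p G → NonCrossing (Edge G)
    Plane⇒NonCrossing G plane {a} {b} {c} {d} a<c c<b b<d ab cd =
      let x , x∈ab , x∈cd = edges-cross a<c c<b b<d in
      disjoint (plane ab cd distinct x (InInterior⇒OnSegment x∈ab) (InInterior⇒OnSegment x∈cd))
      where
      distinct : ¬ ((a ≡ c × b ≡ d) ⊎ (a ≡ d × b ≡ c))
      distinct (inj₁ (≡.refl , _)) = ℕ.<-irrefl ≡.refl a<c
      distinct (inj₂ (_ , ≡.refl)) = ℕ.<-irrefl ≡.refl c<b
      disjoint : ∀ {x} → ¬ CommonEndpoint a b c d x
      disjoint (_ , inj₁ ≡.refl , inj₁ ≡.refl , _) = ℕ.<-irrefl ≡.refl a<c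
      disjoint (_ , inj₁ ≡.refl , inj₂ ≡.refl , _) = ℕ.<-asym a<c (ℕ.<-trans c<b b<d)
      disjoint (_ , inj₂ ≡.refl , inj₁ ≡.refl , _) = ℕ.<-irrefl ≡.refl c<b
      disjoint (_ , inj₂ ≡.refl , inj₂ ≡.refl , _) = ℕ.<-irrefl ≡.refl b<d

    module _ (G : Graph m) (nonCrossing : NonCrossing (Edge G)) where

      ordered-plane : ∀ {a b c d} → a Fin.< b → c Fin.< d → Edge G a b → Edge G c d →
        ¬ (a ≡ c × b ≡ d) → ∀ x → OnSegment (p a) (p b) x → OnSegment (p c) (p d) x →
        CommonEndpoint a b c d x
      ordered-plane {a} {b} {c} {d} a<b c<d ab cd distinct x x∈ab x∈cd with ℕ.≤-total (toℕ a) (toℕ c)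
      ... | inj₁ a≤c = meet-at-endpoint a<b c<d a≤c distinct
        (λ (a<c , c<b , b<d) → nonCrossing a<c c<b b<d ab cd) x∈ab x∈cd
      ... | inj₂ c≤a = swap-edges (meet-at-endpoint c<d a<b c≤a
        (λ (c≡a , d≡b) → distinct (≡.sym c≡a , ≡.sym d≡b))
        (λ (c<a , a<d , d<b) → nonCrossing c<a a<d d<b cd ab) x∈cd x∈ab)

      NonCrossing⇒Plane : Plane p G
      NonCrossing⇒Plane {a} {b} {c} {d} ab cd distinct x x∈ab x∈cd with Fin.<-cmp a b | Fin.<-cmp c d
      ... | tri≈ _ ≡.refl _ | _ = ⊥-elim (Edge-irrefl G ab)
      ... | _ | tri≈ _ ≡.refl _ = ⊥-elim (Edge-irrefl G cd)
      ... | tri< a<b _ _ | tri< c<d _ _ = ordered-plane a<b c<d ab cd (distinct ∘ inj₁) x x∈ab x∈cd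
      ... | tri< a<b _ _ | tri> _ _ d<c = reverseʳ (ordered-plane a<b d<c ab (Edge-sym G cd)
        (distinct ∘ inj₂) x x∈ab (OnSegment-sym x∈cd))
      ... | tri> _ _ b<a | tri< c<d _ _ = reverseˡ (ordered-plane b<a c<d (Edge-sym G ab) cd
        (λ (b≡c , a≡d) → distinct (inj₂ (a≡d , b≡c))) x (OnSegment-sym x∈ab) x∈cd)
      ... | tri> _ _ b<a | tri> _ _ d<c = reverseˡ (reverseʳ
        (ordered-plane b<a d<c (Edge-sym G ab) (Edge-sym G cd)
          (λ (b≡d , a≡c) → distinct (inj₁ (a≡c , b≡d))) x (OnSegment-sym x∈ab) (OnSegment-sym x∈cd)))

  module _ {i} {p : Fin (suc i) → Point} (convex : ConvexCCW p) where

    inject₁-mono : ∀ {a b : Fin i} → a Fin.< b → inject₁ a Fin.< inject₁ b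
    inject₁-mono {a} {b} a<b rewrite Fin.toℕ-inject₁ a | Fin.toℕ-inject₁ b = a<b

    vertices-convex : ConvexCCW (vertices p)
    vertices-convex a<b b<c = convex (inject₁-mono a<b) (inject₁-mono b<c)

    inject₁<fromℕ : ∀ (a : Fin i) → inject₁ a Fin.< fromℕ i
    inject₁<fromℕ a rewrite Fin.toℕ-inject₁ a | Fin.toℕ-fromℕ i = Fin.toℕ<n a

    -- The extra point has the largest label, so an edge covering `k` interleaves with the segment
    -- from `k` to the extra point.
    visible⇒uncovered : ∀ (G : Graph i) k →
      Visible (vertices p) G (extra p) (vertices p k) → Uncovered (Edge G) k
    visible⇒uncovered G k visible a<k k<b ab =
      let x , x∈ab , x∈ku = edges-cross convex (inject₁-mono a<k) (inject₁-mono k<b) (inject₁<fromℕ _) in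
      visible ab x (OnSegment-sym (InInterior⇒OnSegment x∈ku)) x∈ab

    module _ {a b k : Fin i} (a<b : a Fin.< b) where

      -- Labels above `k` lie on the left of the line from the extra point to `k`. If `k` equals
      -- `a`, only the start of the edge is on this line.
      no-meet-left : ∀ {x} → k Fin.≤ a → OnSegment (extra p) (vertices p k) x →
                     ¬ InInterior (vertices p a) (vertices p b) x
      no-meet-left k≤a = interior-separated (left-of-a (Fin.<-cmp k a))
        (left-cab convex (inject₁-mono (ℕ.≤-<-trans k≤a a<b)) (inject₁<fromℕ b))
        where
        left-of-a : _ → 0# ≤ᶠ orientation (extra p) (vertices p k) (vertices p a)
        left-of-a (tri< k<a _ _) = inj₁ (left-cab convex (inject₁-mono k<a) (inject₁<fromℕ a))
        left-of-a (tri≈ _ ≡.refl _) = inj₂ (sym (orientation-end _ _))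
        left-of-a (tri> _ _ a<k) = ⊥-elim (ℕ.<⇒≱ a<k k≤a)

      -- The mirror image: line and edge are both reversed, so that the endpoint possibly on the
      -- line, now `b`, is again the start.
      no-meet-right : ∀ {x} → b Fin.≤ k → OnSegment (vertices p k) (extra p) x →
                      ¬ InInterior (vertices p b) (vertices p a) x
      no-meet-right b≤k = interior-separated (left-of-b (Fin.<-cmp b k))
        (left-bca convex (inject₁-mono (ℕ.<-≤-trans a<b b≤k)) (inject₁<fromℕ k))
        where
        left-of-b : _ → 0# ≤ᶠ orientation (vertices p k) (extra p) (vertices p b)
        left-of-b (tri< b<k _ _) = inj₁ (left-bca convex (inject₁-mono b<k) (inject₁<fromℕ k))
        left-of-b (tri≈ _ ≡.refl _) = inj₂ (sym (orientation-start _ _))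
        left-of-b (tri> _ _ k<b) = ⊥-elim (ℕ.<⇒≱ k<b b≤k)

    -- An edge that does not cover `k` has both of its labels at least `k` or both at most `k`.
    uncovered⇒visible : ∀ (G : Graph i) k →
      Uncovered (Edge G) k → Visible (vertices p) G (extra p) (vertices p k)
    uncovered⇒visible G k uncovered {a} {b} ab x x∈uk x∈ab = disjoint (Fin.<-cmp a b)
      where
      ordered : ∀ {a b} → a Fin.< b → Edge G a b → ¬ InInterior (vertices p a) (vertices p b) x
      ordered {a} {b} a<b ab x∈ab with toℕ a ℕ.<? toℕ k | toℕ k ℕ.<? toℕ b
      ... | yes a<k | yes k<b = uncovered a<k k<b ab
      ... | no a≮k | _ = no-meet-left a<b (ℕ.≮⇒≥ a≮k) x∈uk x∈ab
      ... | _ | no k≮b = no-meet-right a<b (ℕ.≮⇒≥ k≮b) (OnSegment-sym x∈uk) (InInterior-sym x∈ab)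
      disjoint : _ → ⊥
      disjoint (tri< a<b _ _) = ordered a<b ab x∈ab
      disjoint (tri≈ _ ≡.refl _) = Edge-irrefl G ab
      disjoint (tri> _ _ b<a) = ordered b<a (Edge-sym G ab) (InInterior-sym x∈ab)

open import Data.Nat using (_+_; _*_; _^_; _≡ᵇ_; _≤ᵇ_)
open import Relation.Binary.PropositionalEquality using (refl; sym; trans; cong; cong₂; subst; module ≡-Reasoning)

-- Uniqueness of cardinalities, and codes for graphs

-- Duplicate-free lists with the same members are permutations of each other.
HasCardinality-unique : ∀ {a ℓ} {A : Set a} {P : A → Set ℓ} {k l} →
  HasCardinality P k → HasCardinality P l → k ≡ l
HasCardinality-unique hk hl = trans (sym K.size) (trans
  (↭-length (∼bag⇒↭ (unique∧set⇒bag K.unique L.unique (λ {x} → ⇔-trans (K.∈⇔P x) (⇔-sym (L.∈⇔P x))))))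
  L.size)
  where
  module K = HasCardinality hk
  module L = HasCardinality hl

-- A code adds the vertices from last to first, each with the set of its
-- neighbours among the vertices already present.
data Code : ℕ → Set where
  []  : Code 0
  _∷_ : ∀ {i} → Vec Bool i → Code i → Code (suc i)

adjacency : ∀ {i} → Code i → Fin i → Fin i → Bool
adjacency (N ∷ c) zero    zero    = false
adjacency (N ∷ c) zero    (suc b) = lookup N b
adjacency (N ∷ c) (suc a) zero    = lookup N a
adjacency (N ∷ c) (suc a) (suc b) = adjacency c a b

adjacency-sym : ∀ {i} (c : Code i) a b → adjacency c a b ≡ adjacency c b a
adjacency-sym (N ∷ c) zero    zero    = refl
adjacency-sym (N ∷ c) zero    (suc b) = refl
adjacency-sym (N ∷ c) (suc a) zero    = refl
adjacency-sym (N ∷ c) (suc a) (suc b) = adjacency-sym c a b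

adjacency-irrefl : ∀ {i} (c : Code i) a → adjacency c a a ≡ false
adjacency-irrefl (N ∷ c) zero    = refl
adjacency-irrefl (N ∷ c) (suc a) = adjacency-irrefl c a

lookup-injective : ∀ {A : Set} {n} (xs ys : Vec A n) → lookup xs ≗ lookup ys → xs ≡ ys
lookup-injective []       []       eq = refl
lookup-injective (x ∷ xs) (y ∷ ys) eq = cong₂ _∷_ (eq zero) (lookup-injective xs ys (eq ∘ suc))

adjacency-injective : ∀ {i} (c d : Code i) → (∀ a b → adjacency c a b ≡ adjacency d a b) → c ≡ d
adjacency-injective []      []      eq = refl
adjacency-injective (N ∷ c) (M ∷ d) eq = cong₂ _∷_
  (lookup-injective N M (λ k → eq zero (suc k)))
  (adjacency-injective c d (λ a b → eq (suc a) (suc b)))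

-- Only entries above the diagonal are read; symmetry and irreflexivity determine the rest.
encode : ∀ {i} → (Fin i → Fin i → Bool) → Code i
encode {zero}  f = []
encode {suc i} f = tabulate (f zero ∘ suc) ∷ encode (λ a b → f (suc a) (suc b))

adjacency∘encode : ∀ {i} (f : Fin i → Fin i → Bool) → (∀ a b → f a b ≡ f b a) → (∀ a → f a a ≡ false) →
                   ∀ a b → adjacency (encode f) a b ≡ f a b
adjacency∘encode {suc i} f f-sym f-irrefl zero    zero    = sym (f-irrefl zero)
adjacency∘encode {suc i} f f-sym f-irrefl zero    (suc b) = Vec.lookup∘tabulate (f zero ∘ suc) b
adjacency∘encode {suc i} f f-sym f-irrefl (suc a) zero    =
  trans (Vec.lookup∘tabulate (f zero ∘ suc) a) (f-sym zero (suc a))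
adjacency∘encode {suc i} f f-sym f-irrefl (suc a) (suc b) =
  adjacency∘encode (λ a b → f (suc a) (suc b)) (λ a b → f-sym (suc a) (suc b)) (f-irrefl ∘ suc) a b

toMatrix : ∀ {i} → (Fin i → Fin i → Bool) → Vec (Vec Bool i) i
toMatrix f = tabulate (λ a → tabulate (f a))

lookup-toMatrix : ∀ {i} (f : Fin i → Fin i → Bool) a b → lookup (lookup (toMatrix f) a) b ≡ f a b
lookup-toMatrix f a b = trans
  (cong (λ row → lookup row b) (Vec.lookup∘tabulate (λ a → tabulate (f a)) a)) (Vec.lookup∘tabulate (f a) b)

graph : ∀ {i} → Code i → Graph i
graph c = record
  { adjacency   = toMatrix (adjacency c)
  ; symmetric   = λ a b → trans (lookup-toMatrix (adjacency c) a b)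
                    (trans (adjacency-sym c a b) (sym (lookup-toMatrix (adjacency c) b a)))
  ; irreflexive = λ a → trans (lookup-toMatrix (adjacency c) a a) (adjacency-irrefl c a)
  }

graph-injective : ∀ {i} {c d : Code i} → graph c ≡ graph d → c ≡ d
graph-injective {c = c} {d} eq = adjacency-injective c d λ a b →
  trans (sym (lookup-toMatrix (adjacency c) a b))
    (trans (cong (λ G → Graph.adjacent G a b) eq) (lookup-toMatrix (adjacency d) a b))

graph-≡ : ∀ {i} {G H : Graph i} → Graph.adjacency G ≡ Graph.adjacency H → G ≡ H
graph-≡ {G = record { adjacency = _ }} {record { adjacency = _ }} refl = refl

graph∘encode : ∀ {i} (G : Graph i) → G ≡ graph (encode (Graph.adjacent G))
graph∘encode G@record { symmetric = symmetric ; irreflexive = irreflexive } =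
  graph-≡ (lookup-injective _ _ λ a → lookup-injective _ _ λ b → sym (trans
    (lookup-toMatrix (adjacency (encode (Graph.adjacent G))) a b)
    (adjacency∘encode (Graph.adjacent G)
      -- The laws of a graph are irrelevant, but equality of booleans is decidable, so proofs of
      -- them can be recovered.
      (λ a b → recompute (Graph.adjacent G a b Bool.≟ Graph.adjacent G b a) (symmetric a b))
      (λ a → recompute (Graph.adjacent G a a Bool.≟ false) (irreflexive a)) a b)))

subsets : ∀ i → List (Vec Bool i)
subsets zero    = [] ∷ []
subsets (suc i) = cartesianProductWith _∷_ (true ∷ false ∷ []) (subsets i)

-- The smaller code is the outer coordinate, so that all extensions of one code form a consecutive
-- block.
codes : ∀ i → List (Code i)
codes zero    = [] ∷ []
codes (suc i) = cartesianProductWith (λ c N → N ∷ c) (codes i) (subsets i)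

subsets-unique : ∀ i → Unique (subsets i)
subsets-unique zero    = [] ∷ []
subsets-unique (suc i) = Unique.cartesianProductWith⁺ _∷_ Vec.∷-injective
  (((λ ()) ∷ []) ∷ [] ∷ []) (subsets-unique i)

∈-subsets : ∀ {i} (N : Vec Bool i) → N ∈ subsets i
∈-subsets []      = here refl
∈-subsets (b ∷ N) = ∈-cartesianProductWith⁺ _∷_ (∈-bools b) (∈-subsets N)
  where
  ∈-bools : ∀ b → b ∈ true ∷ false ∷ []
  ∈-bools true  = here refl
  ∈-bools false = there (here refl)

codes-unique : ∀ i → Unique (codes i)
codes-unique zero    = [] ∷ []
codes-unique (suc i) = Unique.cartesianProductWith⁺ (λ c N → N ∷ c)
  (λ { refl → refl , refl }) (codes-unique i) (subsets-unique i)

∈-codes : ∀ {i} (c : Code i) → c ∈ codes i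
∈-codes []      = here refl
∈-codes (N ∷ c) = ∈-cartesianProductWith⁺ (λ c N → N ∷ c) (∈-codes c) (∈-subsets N)

-- Planarity and visibility of codes

empty : ∀ {i} → Vec Bool i → Bool
empty []      = true
empty (b ∷ N) = not b ∧ empty N

included : ∀ {i} → Vec Bool i → Vec Bool i → Bool
included []      []      = true
included (b ∷ N) (s ∷ S) = (not b ∨ s) ∧ included N S

-- Joining a new first vertex to N covers the vertices before the last one of N.
uncover : ∀ {i} → Vec Bool i → Vec Bool i → Vec Bool i
uncover []      []      = []
uncover (s ∷ S) (b ∷ N) = (s ∧ empty N) ∷ uncover S N

-- In the cyclic order the extra point is next to index zero as well as to the last index. A new
-- first vertex is therefore visible, and it hides only what its own edges cover.
visible : ∀ {i} → Code i → Vec Bool i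
visible []      = []
visible (N ∷ c) = true ∷ uncover (visible c) N

planar : ∀ {i} → Code i → Bool
planar []      = true
planar (N ∷ c) = planar c ∧ included N (visible c)

Adjacent : ∀ {i} → Code i → Fin i → Fin i → Set
Adjacent c a b = adjacency c a b ≡ true

empty-true : ∀ {i} (N : Vec Bool i) → empty N ≡ true → ∀ k → lookup N k ≢ true
empty-true (false ∷ N) e zero    ()
empty-true (false ∷ N) e (suc k) = empty-true N e k

empty-complete : ∀ {i} (N : Vec Bool i) → (∀ k → lookup N k ≢ true) → empty N ≡ true
empty-complete []          none = refl
empty-complete (true ∷ N)  none = ⊥-elim (none zero refl)
empty-complete (false ∷ N) none = empty-complete N (none ∘ suc)

included-lookup : ∀ {i} (N S : Vec Bool i) → included N S ≡ true →
  ∀ k → lookup N k ≡ true → lookup S k ≡ true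
included-lookup (true ∷ N)  (true ∷ S) N⊆S zero    _  = refl
included-lookup (true ∷ N)  (true ∷ S) N⊆S (suc k) kN = included-lookup N S N⊆S k kN
included-lookup (false ∷ N) (s ∷ S)    N⊆S (suc k) kN = included-lookup N S N⊆S k kN

included-complete : ∀ {i} (N S : Vec Bool i) →
  (∀ k → lookup N k ≡ true → lookup S k ≡ true) → included N S ≡ true
included-complete []          []         N⊆S = refl
included-complete (true ∷ N)  (s ∷ S)    N⊆S rewrite N⊆S zero refl = included-complete N S (N⊆S ∘ suc)
included-complete (false ∷ N) (s ∷ S)    N⊆S = included-complete N S (N⊆S ∘ suc)

∧-true : ∀ {x y} → x ∧ y ≡ true → x ≡ true × y ≡ true
∧-true {true} {true} _ = refl , refl

uncover-lookup : ∀ {i} (S N : Vec Bool i) k → lookup (uncover S N) k ≡ true →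
  lookup S k ≡ true × (∀ l → k Fin.< l → lookup N l ≢ true)
uncover-lookup (s ∷ S) (b ∷ N) zero    eq with s≡true , e ← ∧-true {s} eq =
  s≡true , λ { (suc l) _ → empty-true N e l }
uncover-lookup (s ∷ S) (b ∷ N) (suc k) eq with Sk , none ← uncover-lookup S N k eq =
  Sk , λ { (suc l) (s≤s k<l) → none l k<l }

uncover-complete : ∀ {i} (S N : Vec Bool i) k → lookup S k ≡ true →
  (∀ l → k Fin.< l → lookup N l ≢ true) → lookup (uncover S N) k ≡ true
uncover-complete (s ∷ S) (b ∷ N) zero    refl none = empty-complete N (λ l → none (suc l) (s≤s z≤n))
uncover-complete (s ∷ S) (b ∷ N) (suc k) Sk   none = uncover-complete S N k Sk (λ l k<l → none (suc l) (s≤s k<l))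

-- A covering edge either starts at the new first vertex, and then ends at a later member of `N`, or
-- belongs to the smaller graph.
visible⇒Uncovered : ∀ {i} (c : Code i) k → lookup (visible c) k ≡ true → Uncovered (Adjacent c) k
visible⇒Uncovered (N ∷ c) (suc k) vis {zero}  {suc b} a<k (s≤s k<b) =
  proj₂ (uncover-lookup (visible c) N k vis) b k<b
visible⇒Uncovered (N ∷ c) (suc k) vis {suc a} {suc b} (s≤s a<k) (s≤s k<b) =
  visible⇒Uncovered c k (proj₁ (uncover-lookup (visible c) N k vis)) a<k k<b

Uncovered⇒visible : ∀ {i} (c : Code i) k → Uncovered (Adjacent c) k → lookup (visible c) k ≡ true
Uncovered⇒visible (N ∷ c) zero    unc = refl
Uncovered⇒visible (N ∷ c) (suc k) unc = uncover-complete (visible c) N k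
  (Uncovered⇒visible c k (λ a<k k<b → unc (s≤s a<k) (s≤s k<b)))
  (λ l k<l → unc (s≤s z≤n) (s≤s k<l))

-- The new vertex, being the smallest, can only come first among four interleaved endpoints, and
-- then the other edge covers its neighbour.
planar⇒NonCrossing : ∀ {i} (c : Code i) → planar c ≡ true → NonCrossing (Adjacent c)
planar⇒NonCrossing (N ∷ c) pl {zero} {suc b} {suc k} {suc d} _ (s≤s k<b) (s≤s b<d) 0b kd =
  visible⇒Uncovered c b (included-lookup N (visible c) (proj₂ (∧-true {planar c} pl)) b 0b) k<b b<d kd
planar⇒NonCrossing (N ∷ c) pl {suc a} {suc b} {suc k} {suc d} (s≤s a<k) (s≤s k<b) (s≤s b<d) =
  planar⇒NonCrossing c (proj₁ (∧-true {planar c} pl)) a<k k<b b<d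

NonCrossing⇒planar : ∀ {i} (c : Code i) → NonCrossing (Adjacent c) → planar c ≡ true
NonCrossing⇒planar []      nc = refl
NonCrossing⇒planar (N ∷ c) nc = cong₂ _∧_
  (NonCrossing⇒planar c (λ a<k k<b b<d → nc (s≤s a<k) (s≤s k<b) (s≤s b<d)))
  (included-complete N (visible c) λ b 0b →
    Uncovered⇒visible c b (λ k<b b<d → nc (s≤s z≤n) (s≤s k<b) (s≤s b<d) 0b))

-- Counting in lists

indicator : Bool → ℕ
indicator true  = 1
indicator false = 0

count : ∀ {A : Set} → (A → Bool) → List A → ℕ
count p []       = 0
count p (x ∷ xs) = indicator (p x) + count p xs

length-filterᵇ : ∀ {A : Set} (p : A → Bool) xs → length (filterᵇ p xs) ≡ count p xs
length-filterᵇ p []       = refl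
length-filterᵇ p (x ∷ xs) with p x
... | true  = cong suc (length-filterᵇ p xs)
... | false = length-filterᵇ p xs

count-cong : ∀ {A : Set} {p q : A → Bool} → p ≗ q → ∀ xs → count p xs ≡ count q xs
count-cong p≗q []       = refl
count-cong p≗q (x ∷ xs) = cong₂ _+_ (cong indicator (p≗q x)) (count-cong p≗q xs)

count-false : ∀ {A : Set} (xs : List A) → count (λ _ → false) xs ≡ 0
count-false []       = refl
count-false (x ∷ xs) = count-false xs

count-map : ∀ {A B : Set} (p : B → Bool) (f : A → B) xs → count p (map f xs) ≡ count (p ∘ f) xs
count-map p f []       = refl
count-map p f (x ∷ xs) = cong (indicator (p (f x)) +_) (count-map p f xs)

count-++ : ∀ {A : Set} (p : A → Bool) xs ys → count p (xs ++ ys) ≡ count p xs + count p ys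
count-++ p []       ys = refl
count-++ p (x ∷ xs) ys = trans (cong (indicator (p x) +_) (count-++ p xs ys)) (sym (ℕ.+-assoc (indicator (p x)) _ _))

count-split : ∀ {A : Set} (p q : A → Bool) xs →
  count p xs ≡ count (λ x → q x ∧ p x) xs + count (λ x → not (q x) ∧ p x) xs
count-split p q []       = refl
count-split p q (x ∷ xs) with q x
... | true  = trans (cong (indicator (p x) +_) (count-split p q xs)) (sym (ℕ.+-assoc (indicator (p x)) _ _))
... | false = trans (cong (indicator (p x) +_) (count-split p q xs))
  (x∙yz≈y∙xz (indicator (p x)) (count (λ x → q x ∧ p x) xs) _)
  where open CommutativeSemigroupProperties ℕ.+-commutativeSemigroup using (x∙yz≈y∙xz)

count-subsets : ∀ {i} (p : Vec Bool (suc i) → Bool) →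
  count p (subsets (suc i)) ≡ count (p ∘ (true ∷_)) (subsets i) + count (p ∘ (false ∷_)) (subsets i)
count-subsets {i} p = begin
  count p (map (true ∷_) (subsets i) ++ map (false ∷_) (subsets i) ++ [])
    -- The trailing empty list comes from unfolding the product over the two booleans.
    ≡⟨ cong (λ xs → count p (map (true ∷_) (subsets i) ++ xs)) (List.++-identityʳ _) ⟩
  count p (map (true ∷_) (subsets i) ++ map (false ∷_) (subsets i))
    ≡⟨ count-++ p (map (true ∷_) (subsets i)) _ ⟩
  count p (map (true ∷_) (subsets i)) + count p (map (false ∷_) (subsets i))
    ≡⟨ cong₂ _+_ (count-map p (true ∷_) (subsets i)) (count-map p (false ∷_) (subsets i)) ⟩
  count (p ∘ (true ∷_)) (subsets i) + count (p ∘ (false ∷_)) (subsets i) ∎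
  where open ≡-Reasoning

members : ∀ {i} → Vec Bool i → List (Fin i)
members S = filterᵇ (lookup S) (allFin _)

length-members : ∀ {i} (S : Vec Bool i) → length (members S) ≡ ∣ S ∣
length-members S = trans (length-filterᵇ (lookup S) (allFin _)) (count-lookup S)
  where
  count-lookup : ∀ {i} (S : Vec Bool i) → count (lookup S) (allFin i) ≡ ∣ S ∣
  count-lookup []      = refl
  count-lookup (s ∷ S) = begin
    indicator s + count (lookup (s ∷ S)) (List.tabulate suc)
      ≡⟨ cong (λ xs → indicator s + count (lookup (s ∷ S)) xs) (List.map-tabulate id suc) ⟨
    indicator s + count (lookup (s ∷ S)) (map suc (allFin _))
      ≡⟨ cong (indicator s +_) (count-map (lookup (s ∷ S)) suc (allFin _)) ⟩
    indicator s + count (lookup S) (allFin _)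
      ≡⟨ cong (indicator s +_) (count-lookup S) ⟩
    indicator s + ∣ S ∣
      ≡⟨ indicator-∣∷∣ s ⟩
    ∣ s ∷ S ∣ ∎
    where
    open ≡-Reasoning
    indicator-∣∷∣ : ∀ s → indicator s + ∣ S ∣ ≡ ∣ s ∷ S ∣
    indicator-∣∷∣ true  = refl
    indicator-∣∷∣ false = refl

toT : ∀ {b} → b ≡ true → T b
toT = Equivalence.from Bool.T-≡
fromT : ∀ {b} → T b → b ≡ true
fromT = Equivalence.to Bool.T-≡

members-cardinality : ∀ {i} (S : Vec Bool i) → HasCardinality (λ k → lookup S k ≡ true) ∣ S ∣
members-cardinality S = record
  { elements = members S
  ; unique   = Unique.filter⁺ _ (Unique.allFin⁺ _)
  ; ∈⇔P      = λ k → mk⇔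
      (fromT ∘ proj₂ ∘ ∈-filter⁻ (Bool.T? ∘ lookup S) {xs = allFin _})
      (λ kS → ∈-filter⁺ (Bool.T? ∘ lookup S) (∈-allFin k) (toT kS))
  ; size     = length-members S
  }

-- Counting the neighbour sets of a new vertex

-- The number of nonempty N ⊆ S with w ∣ uncover S N ∣, where ∣ S ∣ = t: the last
-- element of N determines ∣ uncover S N ∣, and the elements before it are free.
cutCount : (ℕ → Bool) → ℕ → ℕ
cutCount w zero    = 0
cutCount w (suc t) = (indicator (w (suc t)) + cutCount w t) + cutCount w t

extends : ∀ {i} → (ℕ → Bool) → Vec Bool i → Vec Bool i → Bool
extends w S N = included N S ∧ w ∣ uncover S N ∣

-- The empty set hides nothing. A first member of `S` then adds one to the number of visible
-- vertices, which shifts the predicate to `w ∘ suc`.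
count-extends-empty : ∀ {i} (w : ℕ → Bool) (S : Vec Bool i) →
  count (λ N → empty N ∧ extends w S N) (subsets i) ≡ indicator (w ∣ S ∣)
count-extends-empty w []      = ℕ.+-identityʳ _
count-extends-empty {suc i} w (s ∷ S) = begin
  count (λ N → empty N ∧ extends w (s ∷ S) N) (subsets (suc i))
    ≡⟨ count-subsets (λ N → empty N ∧ extends w (s ∷ S) N) ⟩
  count (λ _ → false) (subsets i) + count (λ N → empty N ∧ extends w (s ∷ S) (false ∷ N)) (subsets i)
    ≡⟨ cong₂ _+_ (count-false (subsets i)) (step s) ⟩
  indicator (w ∣ s ∷ S ∣) ∎
  where
  open ≡-Reasoning
  keep : ∀ N → empty N ∧ extends w (true ∷ S) (false ∷ N) ≡ empty N ∧ extends (w ∘ suc) S N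
  keep N with empty N
  ... | true  = refl
  ... | false = refl
  step : ∀ s → count (λ N → empty N ∧ extends w (s ∷ S) (false ∷ N)) (subsets i) ≡ indicator (w ∣ s ∷ S ∣)
  step true  = trans (count-cong keep (subsets i)) (count-extends-empty (w ∘ suc) S)
  step false = count-extends-empty w S

-- The first member of `S` may be the only element of `N`, and then all of `S` stays visible.
-- Otherwise, whether in `N` or not, it is hidden by a later element, and the count continues with
-- the rest; this gives the two equal summands of `cutCount`.
count-extends-nonempty : ∀ {i} (w : ℕ → Bool) (S : Vec Bool i) →
  count (λ N → not (empty N) ∧ extends w S N) (subsets i) ≡ cutCount w ∣ S ∣
count-extends-nonempty w [] = refl
count-extends-nonempty {suc i} w (false ∷ S) = begin
  count (λ N → not (empty N) ∧ extends w (false ∷ S) N) (subsets (suc i))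
    ≡⟨ count-subsets (λ N → not (empty N) ∧ extends w (false ∷ S) N) ⟩
  count (λ _ → false) (subsets i) + count (λ N → not (empty N) ∧ extends w S N) (subsets i)
    ≡⟨ cong₂ _+_ (count-false (subsets i)) (count-extends-nonempty w S) ⟩
  cutCount w ∣ S ∣ ∎
  where open ≡-Reasoning
count-extends-nonempty {suc i} w (true ∷ S) = begin
  count (λ N → not (empty N) ∧ extends w (true ∷ S) N) (subsets (suc i))
    ≡⟨ count-subsets (λ N → not (empty N) ∧ extends w (true ∷ S) N) ⟩
  count (λ N → extends w (true ∷ S) (true ∷ N)) (subsets i)
    + count (λ N → not (empty N) ∧ extends w (true ∷ S) (false ∷ N)) (subsets i)
    ≡⟨ cong₂ _+_ (count-split (λ N → extends w (true ∷ S) (true ∷ N)) empty (subsets i))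
         -- Since `true` heads `S`, `extends` computes to the same for both values of the first
         -- entry of `N`, so `drop` applies here too.
         (count-cong drop (subsets i)) ⟩
  count (λ N → empty N ∧ extends w (true ∷ S) (true ∷ N)) (subsets i)
    + count (λ N → not (empty N) ∧ extends w (true ∷ S) (true ∷ N)) (subsets i)
    + count (λ N → not (empty N) ∧ extends w S N) (subsets i)
    ≡⟨ cong₂ _+_ (cong₂ _+_
         (trans (count-cong keep (subsets i)) (count-extends-empty (w ∘ suc) S))
         (trans (count-cong drop (subsets i)) (count-extends-nonempty w S)))
         (count-extends-nonempty w S) ⟩
  indicator (w (suc ∣ S ∣)) + cutCount w ∣ S ∣ + cutCount w ∣ S ∣ ∎
  where
  open ≡-Reasoning
  keep : ∀ N → empty N ∧ extends w (true ∷ S) (true ∷ N) ≡ empty N ∧ extends (w ∘ suc) S N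
  keep N with empty N
  ... | true  = refl
  ... | false = refl
  drop : ∀ N → not (empty N) ∧ extends w (true ∷ S) (true ∷ N) ≡ not (empty N) ∧ extends w S N
  drop N with empty N
  ... | true  = refl
  ... | false = refl

count-extends : ∀ {i} (w : ℕ → Bool) (S : Vec Bool i) →
  count (extends w S) (subsets i) ≡ indicator (w ∣ S ∣) + cutCount w ∣ S ∣
count-extends w S = trans (count-split (extends w S) empty (subsets _))
  (cong₂ _+_ (count-extends-empty w S) (count-extends-nonempty w S))

-- The entries of the production matrix

≡ᵇ-refl : ∀ n → (n ≡ᵇ n) ≡ true
≡ᵇ-refl n = fromT (ℕ.≡⇒≡ᵇ n n refl)

≢⇒≡ᵇ : ∀ {m n} → m ≢ n → (m ≡ᵇ n) ≡ false
≢⇒≡ᵇ {m} {n} m≢n = Bool.¬-not (λ eq → m≢n (ℕ.≡ᵇ⇒≡ m n (toT eq)))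

cutCount-< : ∀ {t x} → t ℕ.< x → cutCount (_≡ᵇ x) t ≡ 0
cutCount-< {zero}  t<x = refl
cutCount-< {suc t} t<x rewrite ≢⇒≡ᵇ (ℕ.<⇒≢ t<x) | cutCount-< {t} (ℕ.<-trans (ℕ.n<1+n t) t<x) = refl

-- The last element of `N` has to be the member of `S` with exactly `x` members after it; the `k`
-- members before it are free.
cutCount-+ : ∀ k x → cutCount (_≡ᵇ suc x) (k + suc x) ≡ 2 ^ k
cutCount-+ zero    x rewrite ≡ᵇ-refl x | cutCount-< (ℕ.n<1+n x) = refl
cutCount-+ (suc k) x rewrite ≢⇒≡ᵇ {k + suc x} {x} (λ eq → ℕ.<-irrefl (sym eq) (ℕ.m≤n+m (suc x) k))
  | cutCount-+ k x = cong (2 ^ k +_) (sym (ℕ.+-identityʳ _))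

-- The indicator accounts for the empty neighbour set, `cutCount` for the others. For `r ≤ s` some
-- old vertex must be hidden, and `s ∸ r + 1` choices are free. For `r` equal to `s + 1` nothing is
-- hidden: either there are no neighbours, or the first visible vertex is the only one. Larger `r`
-- is out of reach.
production-entry : ∀ {n} (r s : Fin n) →
  indicator (toℕ s + 2 ≡ᵇ suc (toℕ r)) + cutCount (_≡ᵇ suc (toℕ r)) (toℕ s + 2) ≡ G n r s
production-entry r s = entry (toℕ r) (toℕ s)
  where
  open ≡-Reasoning
  <+1⇒≤ : ∀ {r s} → r ℕ.< s + 1 → r ≤ s
  <+1⇒≤ {r} {s} r<s+1 = ℕ.s≤s⁻¹ (subst (r ℕ.<_) (ℕ.+-comm s 1) r<s+1)
  >⇒≤ᵇ-false : ∀ {r s} → s ℕ.< r → (r ≤ᵇ s) ≡ false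
  >⇒≤ᵇ-false {r} {s} s<r = Bool.¬-not (λ eq → ℕ.<⇒≱ s<r (ℕ.≤ᵇ⇒≤ r s (toT eq)))
  entry : ∀ r s → indicator (s + 2 ≡ᵇ suc r) + cutCount (_≡ᵇ suc r) (s + 2) ≡
    (if r ≤ᵇ s then 2 ^ (s ∸ r + 1) else if r ≡ᵇ s + 1 then 2 else 0)
  entry r s with ℕ.<-cmp r (s + 1)
  ... | tri< r<s+1 _ _ rewrite fromT (ℕ.≤⇒≤ᵇ (<+1⇒≤ r<s+1)) = begin
    indicator (s + 2 ≡ᵇ suc r) + cutCount (_≡ᵇ suc r) (s + 2)
      ≡⟨ cong₂ _+_ (cong indicator (≢⇒≡ᵇ s+2≢1+r)) (cong (cutCount (_≡ᵇ suc r)) s+2≡) ⟩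
    cutCount (_≡ᵇ suc r) (s ∸ r + 1 + suc r)  ≡⟨ cutCount-+ (s ∸ r + 1) r ⟩
    2 ^ (s ∸ r + 1)                           ∎
    where
    s+2≢1+r : s + 2 ≢ suc r
    s+2≢1+r eq = ℕ.<⇒≢ r<s+1 (sym (ℕ.suc-injective (trans (sym (ℕ.+-suc s 1)) eq)))
    s+2≡ : s + 2 ≡ s ∸ r + 1 + suc r
    s+2≡ = begin
      s + 2                  ≡⟨ cong (_+ 2) (ℕ.m∸n+n≡m (<+1⇒≤ r<s+1)) ⟨
      s ∸ r + r + 2          ≡⟨ ℕ.+-assoc (s ∸ r) r 2 ⟩
      s ∸ r + (r + 2)        ≡⟨ cong (s ∸ r +_) (ℕ.+-comm r 2) ⟩
      s ∸ r + (1 + suc r)    ≡⟨ ℕ.+-assoc (s ∸ r) 1 (suc r) ⟨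
      s ∸ r + 1 + suc r      ∎
  ... | tri≈ _ refl _ rewrite >⇒≤ᵇ-false (ℕ.m<m+n s {1} (s≤s z≤n)) | ≡ᵇ-refl (s + 1) = begin
    indicator (s + 2 ≡ᵇ suc (s + 1)) + cutCount (_≡ᵇ suc (s + 1)) (s + 2)
      ≡⟨ cong (λ t → indicator (t ≡ᵇ suc (s + 1)) + cutCount (_≡ᵇ suc (s + 1)) t) (ℕ.+-suc s 1) ⟩
    indicator (s + 1 ≡ᵇ s + 1) + cutCount (_≡ᵇ suc (s + 1)) (suc (s + 1))
      ≡⟨ cong₂ _+_ (cong indicator (≡ᵇ-refl (s + 1))) (cutCount-+ 0 (s + 1)) ⟩
    2 ∎
  ... | tri> _ r≢s+1 s+1<r rewrite >⇒≤ᵇ-false (ℕ.<-trans (ℕ.m<m+n s {1} (s≤s z≤n)) s+1<r) | ≢⇒≡ᵇ r≢s+1 =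
    cong₂ _+_ (cong indicator (≢⇒≡ᵇ (ℕ.<⇒≢ s+2<1+r))) (cutCount-< s+2<1+r)
    where
    s+2<1+r : s + 2 ℕ.< suc r
    s+2<1+r = subst (ℕ._< suc r) (sym (ℕ.+-suc s 1)) (s≤s s+1<r)

-- The recurrence for the counts of codes

module ∑ = Sum ℕ.+-0-commutativeMonoid

∑-indicator : ∀ {n} (f : Fin n → ℕ) s₀ → ∑.sum (λ s → f s * indicator (toℕ s₀ ≡ᵇ toℕ s)) ≡ f s₀
∑-indicator {suc n} f zero    = begin
  f zero * 1 + ∑.sum (λ s → f (suc s) * 0)
    ≡⟨ cong₂ _+_ (ℕ.*-identityʳ (f zero)) (∑.sum-cong-≗ (λ s → ℕ.*-zeroʳ (f (suc s)))) ⟩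
  f zero + ∑.sum {n} (λ _ → 0)               ≡⟨ cong (f zero +_) (∑.sum-replicate-zero n) ⟩
  f zero + 0                                 ≡⟨ ℕ.+-identityʳ (f zero) ⟩
  f zero                                     ∎
  where open ≡-Reasoning
∑-indicator {suc n} f (suc s₀) = cong₂ _+_ (ℕ.*-zeroʳ (f zero)) (∑-indicator (f ∘ suc) s₀)

hasDegree : ∀ {i} → ℕ → Code i → Bool
hasDegree d c = planar c ∧ (∣ visible c ∣ ≡ᵇ d + 2)

-- No points enter the count, which makes the vectors independent of the configuration.
degreeVector : ∀ {n} → ℕ → Fin n → ℕ
degreeVector i j = count (hasDegree (toℕ j)) (codes i)

visible-fromℕ : ∀ {i} (c : Code (suc i)) → lookup (visible c) (fromℕ i) ≡ true
visible-fromℕ c = Uncovered⇒visible c (fromℕ _) (λ {_} {b} _ i<b _ → ℕ.<⇒≱ i<b (Fin.≤fromℕ b))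

lookup-true⇒∣∣-pos : ∀ {i} (S : Vec Bool i) k → lookup S k ≡ true → 1 ≤ ∣ S ∣
lookup-true⇒∣∣-pos (true ∷ S)  k       _  = s≤s z≤n
lookup-true⇒∣∣-pos (false ∷ S) (suc k) Sk = lookup-true⇒∣∣-pos S k Sk

-- The first and the last vertex are distinct and never covered. The bound permits subtracting 2 to
-- obtain the degree.
2≤∣visible∣ : ∀ {i} (c : Code (suc (suc i))) → 2 ≤ ∣ visible c ∣
2≤∣visible∣ (N ∷ c) = s≤s (lookup-true⇒∣∣-pos (uncover (visible c) N) (fromℕ _) (visible-fromℕ (N ∷ c)))

-- The new vertex is itself visible, so of the `d + 2` visible vertices `suc d` are old ones.
count-extensions : ∀ {i} d (c : Code i) →
  count (λ N → hasDegree d (N ∷ c)) (subsets i) ≡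
  (if planar c then indicator (∣ visible c ∣ ≡ᵇ suc d) + cutCount (_≡ᵇ suc d) ∣ visible c ∣ else 0)
count-extensions {i} d c with planar c
... | true  = trans (count-cong weight (subsets i)) (count-extends (_≡ᵇ suc d) (visible c))
  where
  weight : ∀ N → included N (visible c) ∧ (suc ∣ uncover (visible c) N ∣ ≡ᵇ d + 2) ≡
                 extends (_≡ᵇ suc d) (visible c) N
  weight N rewrite ℕ.+-comm d 2 = refl
... | false = count-false (subsets i)

module _ {n} (r : Fin n) where
  open ≡-Reasoning

  -- A planar code has a single degree, so only the column of that degree contributes to the sum;
  -- for other codes both sides vanish.
  extensions-production : ∀ {i} → 2 ≤ i → i ≤ n → (c : Code i) →
    count (λ N → hasDegree (toℕ r) (N ∷ c)) (subsets i) ≡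
    ∑.sum (λ s → G n r s * indicator (hasDegree (toℕ s) c))
  extensions-production {i} (s≤s (s≤s _)) i≤n c rewrite count-extensions (toℕ r) c with planar c
  ... | false = sym (trans (∑.sum-cong-≗ (λ s → ℕ.*-zeroʳ (G n r s))) (∑.sum-replicate-zero n))
  ... | true = begin
    indicator (∣ visible c ∣ ≡ᵇ suc (toℕ r)) + cutCount (_≡ᵇ suc (toℕ r)) ∣ visible c ∣
      ≡⟨ cong (λ t → indicator (t ≡ᵇ suc (toℕ r)) + cutCount (_≡ᵇ suc (toℕ r)) t) visible≡ ⟩
    indicator (toℕ d + 2 ≡ᵇ suc (toℕ r)) + cutCount (_≡ᵇ suc (toℕ r)) (toℕ d + 2)
      ≡⟨ production-entry r d ⟩
    G n r d
      ≡⟨ ∑-indicator (G n r) d ⟨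
    ∑.sum (λ s → G n r s * indicator (toℕ d ≡ᵇ toℕ s))
      ≡⟨ ∑.sum-cong-≗ (λ s → cong (λ b → G n r s * indicator b) (shift s)) ⟩
    ∑.sum (λ s → G n r s * indicator (∣ visible c ∣ ≡ᵇ toℕ s + 2)) ∎
    where
    -- At most `i` vertices are visible and `i ≤ n`, so the degree is a valid index.
    d<n : ∣ visible c ∣ ∸ 2 ℕ.< n
    d<n = ℕ.<-≤-trans (ℕ.∸-monoʳ-< (s≤s z≤n) (2≤∣visible∣ c)) (ℕ.≤-trans (∣p∣≤n (visible c)) i≤n)
    d : Fin n
    d = Fin.fromℕ< d<n
    visible≡ : ∣ visible c ∣ ≡ toℕ d + 2
    visible≡ = sym (trans (cong (_+ 2) (Fin.toℕ-fromℕ< d<n)) (ℕ.m∸n+n≡m (2≤∣visible∣ c)))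
    shift : ∀ s → (toℕ d ≡ᵇ toℕ s) ≡ (∣ visible c ∣ ≡ᵇ toℕ s + 2)
    shift s = trans (cancel (toℕ d) (toℕ s)) (cong (_≡ᵇ toℕ s + 2) (sym visible≡))
      where
      cancel : ∀ k l → (k ≡ᵇ l) ≡ (k + 2 ≡ᵇ l + 2)
      cancel k l rewrite ℕ.+-comm k 2 | ℕ.+-comm l 2 = refl

  degreeVector-production : ∀ i → 2 ≤ i → i ≤ n → degreeVector (suc i) r ≡ (G n · degreeVector i) r
  degreeVector-production i 2≤i i≤n = production (codes i)
    where
    -- Both sides are additive in the list of codes, so the claim is proved for arbitrary lists,
    -- where induction is possible.
    production : ∀ cs →
      count (hasDegree (toℕ r)) (cartesianProductWith (λ c N → N ∷ c) cs (subsets i)) ≡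
      ∑.sum (λ s → G n r s * count (hasDegree (toℕ s)) cs)
    production [] = sym (trans (∑.sum-cong-≗ (λ s → ℕ.*-zeroʳ (G n r s))) (∑.sum-replicate-zero n))
    production (c ∷ cs) = begin
      count (hasDegree (toℕ r))
        (map (_∷ c) (subsets i) ++ cartesianProductWith (λ c N → N ∷ c) cs (subsets i))
        ≡⟨ count-++ (hasDegree (toℕ r)) (map (_∷ c) (subsets i)) _ ⟩
      count (hasDegree (toℕ r)) (map (_∷ c) (subsets i))
        + count (hasDegree (toℕ r)) (cartesianProductWith (λ c N → N ∷ c) cs (subsets i))
        ≡⟨ cong₂ _+_
             (trans (count-map (hasDegree (toℕ r)) (_∷ c) (subsets i)) (extensions-production 2≤i i≤n c))
             (production cs) ⟩
      ∑.sum (λ s → G n r s * indicator (hasDegree (toℕ s) c))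
        + ∑.sum (λ s → G n r s * count (hasDegree (toℕ s)) cs)
        ≡⟨ ∑.∑-distrib-+ (λ s → G n r s * indicator (hasDegree (toℕ s) c)) _ ⟨
      ∑.sum (λ s → G n r s * indicator (hasDegree (toℕ s) c) + G n r s * count (hasDegree (toℕ s)) cs)
        ≡⟨ ∑.sum-cong-≗ (λ s → ℕ.*-distribˡ-+ (G n r s) _ (count (hasDegree (toℕ s)) cs)) ⟨
      ∑.sum (λ s → G n r s * count (hasDegree (toℕ s)) (c ∷ cs)) ∎

-- Transfer from codes to geometric graphs

HasCardinality-⇔ : ∀ {a ℓ₁ ℓ₂} {A : Set a} {P : A → Set ℓ₁} {Q : A → Set ℓ₂} {k} →
  (∀ x → P x ⇔ Q x) → HasCardinality P k → HasCardinality Q k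
HasCardinality-⇔ P⇔Q card = record
  { elements = elements ; unique = unique ; ∈⇔P = λ x → ⇔-trans (∈⇔P x) (P⇔Q x) ; size = size }
  where open HasCardinality card

NonCrossing-⊆ : ∀ {i} {E E′ : Fin i → Fin i → Set} → (∀ {a b} → E a b → E′ a b) →
  NonCrossing E′ → NonCrossing E
NonCrossing-⊆ E⊆E′ nc a<c c<b b<d ab cd = nc a<c c<b b<d (E⊆E′ ab) (E⊆E′ cd)

Edge⇒Adjacent : ∀ {i} (c : Code i) {a b} → Edge (graph c) a b → Adjacent c a b
Edge⇒Adjacent c {a} {b} = trans (sym (lookup-toMatrix (adjacency c) a b))

Adjacent⇒Edge : ∀ {i} (c : Code i) {a b} → Adjacent c a b → Edge (graph c) a b
Adjacent⇒Edge c {a} {b} = trans (lookup-toMatrix (adjacency c) a b)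

module _ {c ℓ₁ ℓ₂} (F : OrderedField c ℓ₁ ℓ₂) where
  open Geometry F
  open ConvexPosition F

  module _ {i} {p : Fin (suc i) → Point} (convex : ConvexCCW p) where

    Plane⇒planar : ∀ (x : Code i) → Plane (vertices p) (graph x) → planar x ≡ true
    Plane⇒planar x plane = NonCrossing⇒planar x
      (NonCrossing-⊆ (Adjacent⇒Edge x) (Plane⇒NonCrossing (vertices-convex convex) (graph x) plane))

    planar⇒Plane : ∀ (x : Code i) → planar x ≡ true → Plane (vertices p) (graph x)
    planar⇒Plane x pl = NonCrossing⇒Plane (vertices-convex convex) (graph x)
      (NonCrossing-⊆ (Edge⇒Adjacent x) (planar⇒NonCrossing x pl))

    visible⇒Visible : ∀ (x : Code i) k →
      lookup (visible x) k ≡ true → Visible (vertices p) (graph x) (extra p) (vertices p k)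
    visible⇒Visible x k vis = uncovered⇒visible convex (graph x) k
      (λ a<k k<b ab → visible⇒Uncovered x k vis a<k k<b (Edge⇒Adjacent x ab))

    Visible⇒visible : ∀ (x : Code i) k →
      Visible (vertices p) (graph x) (extra p) (vertices p k) → lookup (visible x) k ≡ true
    Visible⇒visible x k vis = Uncovered⇒visible x k
      (λ a<k k<b ab → visible⇒uncovered convex (graph x) k vis a<k k<b (Adjacent⇒Edge x ab))

    visible-cardinality : ∀ (x : Code i) →
      HasCardinality (λ k → Visible (vertices p) (graph x) (extra p) (vertices p k)) ∣ visible x ∣
    visible-cardinality x = HasCardinality-⇔
      (λ k → mk⇔ (visible⇒Visible x k) (Visible⇒visible x k)) (members-cardinality (visible x))

    IsPlaneOfDegree : ℕ → Graph i → Set _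
    IsPlaneOfDegree d H = Plane (vertices p) H × HasVisibilityDegree p H d

    hasDegree⇒ : ∀ d (x : Code i) → T (hasDegree d x) → IsPlaneOfDegree d (graph x)
    hasDegree⇒ d x deg =
      let pl , vis = Equivalence.to Bool.T-∧ deg in
      planar⇒Plane x (fromT pl) , subst (HasCardinality _) (ℕ.≡ᵇ⇒≡ _ _ vis) (visible-cardinality x)

    -- The visible vertices are counted once by the code and once by the assumed degree; uniqueness
    -- of cardinalities identifies the two numbers.
    ⇒hasDegree : ∀ d (x : Code i) → IsPlaneOfDegree d (graph x) → T (hasDegree d x)
    ⇒hasDegree d x (plane , deg) = Equivalence.from Bool.T-∧
      (toT (Plane⇒planar x plane) , ℕ.≡⇒≡ᵇ _ _ (HasCardinality-unique (visible-cardinality x) deg))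

    degreeVector-isVisibilityVector : ∀ {n} → IsVisibilityVector {n = n} p (degreeVector i)
    degreeVector-isVisibilityVector j = record
      { elements = map graph (filterᵇ (hasDegree (toℕ j)) (codes i))
      ; unique   = Unique.map⁺ graph-injective (Unique.filter⁺ _ (codes-unique i))
      ; ∈⇔P      = λ H → mk⇔ (to H) (from H)
      ; size     = trans (List.length-map graph (filterᵇ (hasDegree (toℕ j)) (codes i)))
                     (length-filterᵇ (hasDegree (toℕ j)) (codes i))
      }
      where
      P? = Bool.T? ∘ hasDegree {i} (toℕ j)
      P = IsPlaneOfDegree (toℕ j)
      to : ∀ H → H ∈ map graph (filterᵇ (hasDegree (toℕ j)) (codes i)) → P H
      to H H∈ =
        let x , x∈ , H≡ = ∈-map⁻ graph H∈ in
        subst P (sym H≡) (hasDegree⇒ (toℕ j) x (proj₂ (∈-filter⁻ P? {xs = codes i} x∈)))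
      from : ∀ H → P H → H ∈ map graph (filterᵇ (hasDegree (toℕ j)) (codes i))
      from H PH = subst (_∈ _) (sym H≡)
        (∈-map⁺ graph (∈-filter⁺ P? (∈-codes x) (⇒hasDegree (toℕ j) x (subst P H≡ PH))))
        where
        x = encode (Graph.adjacent H)
        H≡ : H ≡ graph x
        H≡ = graph∘encode H

theorem8 : ∀ {c ℓ₁ ℓ₂} (F : OrderedField c ℓ₁ ℓ₂) (n : ℕ) → 2 ≤ n → IsProductionMatrix F n (G n)
theorem8 F n 2≤n =
  degreeVector ,
  (λ i _ _ p convex → degreeVector-isVisibilityVector F convex) ,
  (λ i 2≤i i≤n r → degreeVector-production r i 2≤i i≤n)
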